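{- Any algorithm in the CONGEST model for testing $C_5$-freeness whose running time does not depend on the size $n$ of the graph or the number of edges $m$ (i.e. whose round complexity is a function of $\epsilon$ alone) requires $\widetilde{\Omega}(1/\sqrt{\epsilon})$ rounds.
   Context: CONGEST model: the network is an undirected graph $G=(V,E)$ with $n=|V|$ nodes and $m=|E|$ edges, nodes have unique $O(\log n)$-bit identifiers; computation is synchronous, and in each round every node may send $O(\log n)$ bits over each incident edge; nodes may use randomness. $C_5$ is the 5-cycle; $G$ is $C_5$-free if it contains no (not necessarily induced) subgraph isomorphic to $C_5$. $G$ is $\epsilon$-far from a property if at least $\epsilon|E|$ edges must be added to or removed from $E$ to obtain a graph with the property. $\widetilde\Omega$ hides polylogarithmic factors. Testing $C_5$-freeness with parameter $0<\epsilon\le 1$: if $G$ is $C_5$-free then with probability at least $2/3$ all nodes accept; if $G$ is $\epsilon$-far from $C_5$-free then with probability at least $2/3$ some node rejects. -}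

module Defs where

open import Data.Bool.Base using (Bool; true; false; not; _xor_)
open import Data.Bool.ListAction using (all; any)
import Data.Bool.Properties as Bool
open import Data.Fin.Base using (Fin; toℕ; finToFun)
open import Data.Fin.Properties using (any?; all?; _≟_; _<?_)
open import Data.Fin.Subset using (Subset; ∣_∣)
open import Data.Integer.Base as ℤ using (+_)
open import Data.List.Base using (List; allFin; cartesianProduct; filter; filterᵇ; length)
open import Data.Maybe.Base as Maybe using (Maybe; just; nothing; is-just)
open import Data.Nat.Base using (ℕ; zero; suc; _*_; _^_; _<_; _%_; NonZero)
open import Data.Nat.Logarithm using (⌈log₂_⌉)
import Data.Nat.Properties as ℕ
open import Data.Product.Base using (Σ-syntax; _×_; _,_; uncurry)
open import Data.Rational.Base as ℚ using (ℚ; 0ℚ; 1ℚ; Positive; ceiling)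
import Data.Rational.Properties as ℚ
open import Data.Vec.Base using (Vec; tabulate)
open import Data.Vec.Bounded.Base using (Vec≤)
open import Function.Base using (_∘_)
open import Function.Definitions using (Injective)
open import Relation.Binary.PropositionalEquality using (_≡_)
open import Relation.Nullary.Decidable using (yes; no; does; from-yes; _×-dec_; _⊎-dec_)
open import Relation.Nullary.Negation using (¬_)

fromℕ : ℕ → ℚ
fromℕ k = + k ℚ./ 1

------------------------------------------------------------------------
-- Finite simple graphs

record Graph (n : ℕ) : Set where
  field
    adj    : Fin n → Fin n → Bool
    sym    : ∀ u v → adj u v ≡ adj v u
    irrefl : ∀ v → adj v v ≡ false

open Graph public

-- Each unordered pair of distinct vertices once, as (u , v) with u < v.
pairs : ∀ n → List (Fin n × Fin n)
pairs n = filter (uncurry _<?_) (cartesianProduct (allFin n) (allFin n))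

∣E_∣ : ∀ {n} → Graph n → ℕ
∣E_∣ {n} G = length (filterᵇ (uncurry (adj G)) (pairs n))

-- Number of edge insertions and deletions needed to turn G into H,
-- i.e. the size of the symmetric difference of the edge sets.
editDistance : ∀ {n} → Graph n → Graph n → ℕ
editDistance {n} G H =
  length (filterᵇ (λ (u , v) → adj G u v xor adj H u v) (pairs n))

-- Subgraphs are not necessarily induced: only edges have to be preserved.
_ContainsCopyOf_ : ∀ {n k} → Graph n → Graph k → Set
_ContainsCopyOf_ {n} {k} G F =
  Σ[ f ∈ (Fin k → Fin n) ] Injective _≡_ _≡_ f ×
    (∀ i j → adj F i j ≡ true → adj G (f i) (f j) ≡ true)

C₅ : Graph 5
C₅ = record
  { adj    = adj₅
  ; sym    = from-yes (all? λ i → all? λ j → adj₅ i j Bool.≟ adj₅ j i)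
  ; irrefl = from-yes (all? λ i → adj₅ i i Bool.≟ false)
  }
  where
  adj₅ : Fin 5 → Fin 5 → Bool
  adj₅ i j = does ((toℕ j ℕ.≟ suc (toℕ i) % 5) ⊎-dec (toℕ i ℕ.≟ suc (toℕ j) % 5))

C₅-free : ∀ {n} → Graph n → Set
C₅-free G = ¬ (G ContainsCopyOf C₅)

-- The condition 0 < |E| only excludes edgeless graphs.  Without it, these
-- would be vacuously ε-far from every property, including those they have
-- (ε|E| = 0), so that no tester for C₅-freeness could exist.
_-FarFrom_ : ℚ → ∀ {n} → (Graph n → Set) → Graph n → Set
(ε -FarFrom P) G =
  0 < ∣E G ∣ ×
  (∀ H → P H → ε ℚ.* fromℕ ∣E G ∣ ℚ.≤ fromℕ (editDistance G H))

------------------------------------------------------------------------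
-- The CONGEST model

-- The O(log n) bounds are explicit: messages have at most β⌈log₂ n⌉ bits,
-- identifiers have γ⌈log₂ n⌉ bits.
module CONGEST (β γ : ℕ) where

  Message : ℕ → Set
  Message n = Vec≤ Bool (β * ⌈log₂ n ⌉)

  #IDs : ℕ → ℕ
  #IDs n = 2 ^ (γ * ⌈log₂ n ⌉)

  ID : ℕ → Set
  ID n = Fin (#IDs n)

  record Network (n : ℕ) : Set where
    field
      graph        : Graph n
      id           : Fin n → ID n
      id-injective : Injective _≡_ _≡_ id

  -- The program run by every node of an n-node network.  A node knows n, its
  -- own identifier and those of its neighbours, and has a private random seed,
  -- uniform on Fin seeds.  In each round it sends a message to each neighbour
  -- (addressed by identifier; possibly a different one to each) and then
  -- updates its state from the messages received, which are indexed by the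
  -- sender's identifier, with nothing for identifiers of non-neighbours.
  -- Local computation is unrestricted.
  record Program (n : ℕ) : Set₁ where
    field
      seeds            : ℕ
      .{{seeds-nonZero}} : NonZero seeds
      State            : Set
      init             : (own : ID n) (neighbours : Subset (#IDs n)) → Fin seeds → State
      send             : State → (recipient : ID n) → Message n
      receive          : State → Vec (Maybe (Message n)) (#IDs n) → State
      accepts          : State → Bool

  module Execution {n : ℕ} (P : Program n) (N : Network n) where
    open Program P
    open Network N

    neighbour : Fin n → ID n → Maybe (Fin n)
    neighbour v a with any? (λ u → (adj graph v u Bool.≟ true) ×-dec (id u ≟ a))
    ... | yes (u , _) = just u
    ... | no _        = nothing

    neighbourIDs : Fin n → Subset (#IDs n)
    neighbourIDs v = tabulate (is-just ∘ neighbour v)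

    inbox : (Fin n → State) → Fin n → Vec (Maybe (Message n)) (#IDs n)
    inbox σ v = tabulate λ a → Maybe.map (λ u → send (σ u) (id v)) (neighbour v a)

    -- An outcome encodes, via finToFun, the independent seeds of all n nodes.
    Outcome : Set
    Outcome = Fin (seeds ^ n)

    stateAfter : ℕ → Outcome → Fin n → State
    stateAfter zero    ω v = init (id v) (neighbourIDs v) (finToFun ω v)
    stateAfter (suc t) ω v = receive (stateAfter t ω v) (inbox (stateAfter t ω) v)

    allAccept someRejects : ℕ → Outcome → Bool
    allAccept   t ω = all (λ v → accepts (stateAfter t ω v)) (allFin n)
    someRejects t ω = any (λ v → not (accepts (stateAfter t ω v))) (allFin n)

    Pr : (Outcome → Bool) → ℚ
    Pr event = (+ ∣ tabulate event ∣) ℚ./ (seeds ^ n)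
      where instance _ = ℕ.m^n≢0 seeds n

  -- Algorithms may depend arbitrarily on ε and n.
  Algorithm : Set₁
  Algorithm = (ε : ℚ) (n : ℕ) → Program n

  TestsC₅-freenessIn_Rounds : (ℚ → ℕ) → Algorithm → Set
  TestsC₅-freenessIn_Rounds T A =
    ∀ ε → 0ℚ ℚ.< ε → ε ℚ.≤ 1ℚ → ∀ n (N : Network n) →
      let open Network N
          open Execution (A ε n) N
      in (C₅-free graph → + 2 ℚ./ 3 ℚ.≤ Pr (allAccept (T ε))) ×
         ((ε -FarFrom C₅-free) graph → + 2 ℚ./ 3 ℚ.≤ Pr (someRejects (T ε)))

------------------------------------------------------------------------
-- The lower bound

log1/ : (ε : ℚ) .{{_ : Positive ε}} → ℕ
log1/ ε = ⌈log₂ ℤ.∣ ceiling ((ℚ.1/ ε) {{ℚ.pos⇒nonZero ε}}) ∣ ⌉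

-- t ≥ 1 / (C · √ε · log(1/ε)ᵏ), multiplied out and squared.
AtLeastΩ̃1/√ : (C k : ℕ) (ε : ℚ) .{{_ : Positive ε}} → ℕ → Set
AtLeastΩ̃1/√ C k ε t = 1ℚ ℚ.≤ ε ℚ.* fromℕ ((C * log1/ ε ^ k * t) ^ 2)

{-# OPTIONS --safe #-}

-- Take n ≈ 1/√ε nodes up to logarithms, so that ε|E| ≤ 1 and testing amounts to
-- detecting a single C₅.  Two parties holding x, y ⊆ [s]×[s] split a blow-up of
-- C₅ with 5s nodes in which a C₅ exists iff x and y meet, and which has only 2s
-- cut edges, forming a matching.  A T-round algorithm thus covers its accepting
-- runs, for each outcome of the coins, by 2^Õ(sT) rectangles.
--
-- Rectangles cannot do this unless sT = Ω̃(s²), by Razborov's corruption bound: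
-- a rectangle that is not exponentially small has, up to a constant factor, as
-- much mass on pairs meeting in exactly one point as on disjoint pairs.  Indeed
-- if a family of subsets of W has few members through i for many i ∈ W, then its
-- members hit these i with density below 1/4, so the family is exponentially
-- small.  The constant factor is overcome by taking fifth powers of the
-- acceptance counts.
module Submission where

open import Defs hiding (sym)
open import Data.Bool.Base using (Bool; true; false; not; _∧_; _∨_; _xor_; if_then_else_; T)
open import Data.Bool.ListAction using (all; any)
import Data.Bool.Properties as Bool
open import Data.Fin.Base as Fin using (Fin; zero; suc; toℕ; _↑ˡ_; _↑ʳ_; splitAt; combine; remQuot; finToFun; funToFin; inject≤)
open import Data.Fin.Patterns
open import Data.Fin.Properties as Fin using (any?; all?; _≟_; splitAt-↑ˡ; splitAt-↑ʳ; remQuot-combine; combine-remQuot; combine-injectiveˡ; funToFin-finToFin; finToFun-funToFin; inject≤-injective)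
open import Data.Fin.Subset using (Subset; ⊤; ∁; _∩_; ∣_∣)
open import Data.Fin.Subset.Properties using (∩-identityʳ; ∣p∣≤n)
open import Data.Integer.Base as ℤ using (+[1+_]; -[1+_])
import Data.Integer.DivMod as ℤ
import Data.Integer.Properties as ℤ
open import Data.List.Base as List using (List; []; _∷_; _++_; map; concatMap; length; allFin; cartesianProduct; filterᵇ)
open import Data.List.Membership.Propositional using (_∈_)
open import Data.List.Membership.Propositional.Properties using (∈-filter⁺; ∈-cartesianProduct⁺; ∈-allFin)
open import Data.List.Properties using (map-tabulate; length-++; length-map; length-filter; length-tabulate)
open import Data.List.Relation.Unary.Any using (here; there)
open import Data.Maybe.Base as Maybe using (Maybe; just; nothing; is-just)
open import Data.Nat.Base as ℕ
open import Data.Nat.Coprimality as Coprime using (Coprime)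
open import Data.Nat.DivMod using (_mod_)
open import Data.Nat.Induction using (<-rec)
open import Data.Nat.Logarithm using (⌈log₂_⌉; ⌈log₂⌉-mono-≤; ⌈log₂⌈n/2⌉⌉≡⌈log₂n⌉∸1)
open import Data.Nat.Properties as ℕ hiding (_≟_)
open import Data.Nat.Tactic.RingSolver using (solve-∀)
open import Data.Product.Base using (_×_; _,_; proj₁; proj₂; ∃-syntax; uncurry)
open import Data.Rational.Base as ℚ using (ℚ; 0ℚ; 1ℚ; mkℚ; Positive; toℚᵘ; ceiling)
import Data.Rational.Properties as ℚ
open import Data.Rational.Unnormalised.Base as ℚᵘ using (mkℚᵘ; *≤*)
import Data.Rational.Unnormalised.Properties as ℚᵘ
open import Data.Sum.Base using (inj₁; inj₂)
open import Data.Vec.Base as Vec using (Vec; []; _∷_; lookup; insertAt; tabulate)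
open import Data.Vec.Bounded.Base as Vec≤ using (Vec≤)
open import Data.Vec.Properties using (lookup∘tabulate; lookup-zipWith; insertAt-lookup; map-insertAt; tabulate-cong; tabulate-∘)
open import Function.Base using (_∘_; id)
open import Function.Definitions using (Injective)
open import Relation.Binary.Definitions using (tri<; tri≈; tri>)
open import Relation.Binary.PropositionalEquality
open import Relation.Nullary.Decidable using (yes; no; does; from-yes; T?; dec-true; _×-dec_; _→-dec_)
open import Relation.Nullary.Negation using (contradiction; ¬_)

-- That the round count depends on ε alone is what allows `n` to be chosen after `T ε` is known: the
-- gadget is made just large enough for disjointness to be too hard for that many rounds, and a
-- small round count is exactly what keeps ε n² at most 1.
--
-- Disjoint and meeting pairs come from a single experiment: a point i, a partition of the other
-- points into P and its complement, and a random subset of each part. The two kinds of pair differ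
-- only in whether i is put into both sets or into neither. For a disjoint pair, the second party's
-- factor depends on W = P ∪ {i} but not on which point of W is i. This is why it is enough to study
-- a single family of subsets inside a fixed W.
--
-- Densities are never divided out: counts are compared after multiplication by one base per
-- coordinate. In the corruption bound the whole mass is of order 640 to the N and the error is of
-- order 638 to the N, so a rectangle escapes the bound only with a share of order 319/320 to the N.
-- This ratio is the source of the constant 319 at the end.

private
  variable
    Index Index′ : Set

-- Finite sums and indicators

∑ : List Index → (Index → ℕ) → ℕ
∑ []       f = 0
∑ (x ∷ xs) f = f x + ∑ xs f

infix 5 ∑
syntax ∑ xs (λ x → e) = ∑[ x ∈ xs ] e

∑-cong : ∀ (xs : List Index) {f g : Index → ℕ} → (∀ x → f x ≡ g x) → ∑ xs f ≡ ∑ xs g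
∑-cong []       f≡g = refl
∑-cong (x ∷ xs) f≡g = cong₂ _+_ (f≡g x) (∑-cong xs f≡g)

∑-mono : ∀ (xs : List Index) {f g : Index → ℕ} → (∀ x → f x ≤ g x) → ∑ xs f ≤ ∑ xs g
∑-mono []       f≤g = z≤n
∑-mono (x ∷ xs) f≤g = +-mono-≤ (f≤g x) (∑-mono xs f≤g)

∑-zero : ∀ (xs : List Index) → ∑[ x ∈ xs ] 0 ≡ 0
∑-zero []       = refl
∑-zero (x ∷ xs) = ∑-zero xs

∑-const : ∀ (xs : List Index) c → ∑[ x ∈ xs ] c ≡ length xs * c
∑-const []       c = refl
∑-const (x ∷ xs) c = cong (c +_) (∑-const xs c)

∑-+ : ∀ (xs : List Index) (f g : Index → ℕ) → ∑[ x ∈ xs ] (f x + g x) ≡ ∑ xs f + ∑ xs g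
∑-+ []       f g = refl
∑-+ (x ∷ xs) f g = trans (cong (f x + g x +_) (∑-+ xs f g)) (shuffle (f x) (g x) _ _)
  where
  shuffle : ∀ a b c d → a + b + (c + d) ≡ a + c + (b + d)
  shuffle = solve-∀

∑-*ˡ : ∀ (xs : List Index) c (f : Index → ℕ) → ∑[ x ∈ xs ] (c * f x) ≡ c * ∑ xs f
∑-*ˡ []       c f = sym (*-zeroʳ c)
∑-*ˡ (x ∷ xs) c f = trans (cong (c * f x +_) (∑-*ˡ xs c f)) (sym (*-distribˡ-+ c (f x) _))

∑-*ʳ : ∀ (xs : List Index) c (f : Index → ℕ) → ∑[ x ∈ xs ] (f x * c) ≡ ∑ xs f * c
∑-*ʳ xs c f = trans (∑-cong xs λ x → *-comm (f x) c) (trans (∑-*ˡ xs c f) (*-comm c _))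

∑-++ : ∀ (xs ys : List Index) (f : Index → ℕ) → ∑ (xs ++ ys) f ≡ ∑ xs f + ∑ ys f
∑-++ []       ys f = refl
∑-++ (x ∷ xs) ys f = trans (cong (f x +_) (∑-++ xs ys f)) (sym (+-assoc (f x) _ _))

∑-map : ∀ (h : Index′ → Index) xs (f : Index → ℕ) → ∑ (map h xs) f ≡ ∑[ x ∈ xs ] f (h x)
∑-map h []       f = refl
∑-map h (x ∷ xs) f = cong (f (h x) +_) (∑-map h xs f)

∑-concatMap : ∀ (h : Index′ → List Index) xs (f : Index → ℕ) →
              ∑ (concatMap h xs) f ≡ ∑[ x ∈ xs ] ∑ (h x) f
∑-concatMap h []       f = refl
∑-concatMap h (x ∷ xs) f =
  trans (∑-++ (h x) (concatMap h xs) f) (cong (∑ (h x) f +_) (∑-concatMap h xs f))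

∑-swap : ∀ (xs : List Index) (ys : List Index′) (f : Index → Index′ → ℕ) →
         ∑[ x ∈ xs ] ∑[ y ∈ ys ] f x y ≡ ∑[ y ∈ ys ] ∑[ x ∈ xs ] f x y
∑-swap []       ys f = sym (∑-zero ys)
∑-swap (x ∷ xs) ys f =
  trans (cong (∑ ys (f x) +_) (∑-swap xs ys f)) (sym (∑-+ ys (f x) _))

length≡∑1 : ∀ (xs : List Index) → length xs ≡ ∑[ x ∈ xs ] 1
length≡∑1 xs = sym (trans (∑-const xs 1) (*-identityʳ _))

∑-allFin-suc : ∀ n (f : Fin (suc n) → ℕ) → ∑ (allFin (suc n)) f ≡ f zero + (∑[ i ∈ allFin n ] f (suc i))
∑-allFin-suc n f = cong (f zero +_)
  (trans (cong (λ is → ∑ is f) (sym (map-tabulate id suc))) (∑-map suc (allFin n) f))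

𝟙 : Bool → ℕ
𝟙 true  = 1
𝟙 false = 0

𝟙-∧ : ∀ a b → 𝟙 (a ∧ b) ≡ 𝟙 a * 𝟙 b
𝟙-∧ true  b = sym (+-identityʳ (𝟙 b))
𝟙-∧ false b = refl

𝟙≤1 : ∀ a → 𝟙 a ≤ 1
𝟙≤1 true  = ≤-refl
𝟙≤1 false = z≤n

𝟙*≤ : ∀ a n → 𝟙 a * n ≤ n
𝟙*≤ a n = ≤-trans (*-monoˡ-≤ n (𝟙≤1 a)) (≤-reflexive (*-identityˡ n))

-- Thin families of subsets

below : ∀ {n} → Subset n → List (Subset n)
below []          = [] ∷ []
below (false ∷ W) = map (false ∷_) (below W)
below (true  ∷ W) = map (false ∷_) (below W) ++ map (true ∷_) (below W)

∑-below-true : ∀ {n} (W : Subset n) f →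
               ∑ (below (true ∷ W)) f ≡ (∑[ x ∈ below W ] f (false ∷ x)) + (∑[ x ∈ below W ] f (true ∷ x))
∑-below-true W f = trans (∑-++ (map (false ∷_) (below W)) _ f)
  (cong₂ _+_ (∑-map (false ∷_) (below W) f) (∑-map (true ∷_) (below W) f))

-- Relative to 54, an element of D that is hit weighs (2/3)³ and one that is
-- missed weighs 3/2.
weight : ∀ {n} → Bool → Subset n → Subset n → ℕ
weight q []          []      = 1
weight q (false ∷ D) (b ∷ x) = weight q D x
weight q (true ∷ D)  (b ∷ x) = (if q xor b then 16 else 81) * weight q D x

-- The flag `q` replaces x by its complement, so that points lying in few members and points missed
-- by few members are handled by one argument.
hits : ∀ {n} → Bool → Subset n → Subset n → ℕ
hits q D x = ∣ D ∩ Vec.map (q xor_) x ∣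

weight≡ : ∀ {n} q (D x : Subset n) →
          ∃[ m ] (hits q D x + m ≡ ∣ D ∣ × weight q D x ≡ 16 ^ hits q D x * 81 ^ m)
weight≡ q [] [] = 0 , refl , refl
weight≡ q (false ∷ D) (b ∷ x) = weight≡ q D x
weight≡ q (true ∷ D) (b ∷ x) with weight≡ q D x | q xor b
... | m , k+m≡d , w≡ | true  = m , cong suc k+m≡d ,
  trans (cong (16 *_) w≡) (sym (*-assoc 16 (16 ^ hits q D x) (81 ^ m)))
... | m , k+m≡d , w≡ | false = suc m , trans (+-suc (hits q D x) m) (cong suc k+m≡d) ,
  trans (cong (81 *_) w≡) (lemma 81 (16 ^ hits q D x) (81 ^ m))
  where
  lemma : ∀ a b c → a * (b * c) ≡ b * (a * c)
  lemma = solve-∀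

^-*-distrib : ∀ a b n → (a * b) ^ n ≡ a ^ n * b ^ n
^-*-distrib a b zero    = refl
^-*-distrib a b (suc n) = trans (cong (a * b *_) (^-*-distrib a b n)) (lemma a b (a ^ n) (b ^ n))
  where
  lemma : ∀ a b c d → a * b * (c * d) ≡ a * c * (b * d)
  lemma = solve-∀

bernoulli⁺ : ∀ j → 54 ^ j * (2 + j) ≤ 2 * 81 ^ j
bernoulli⁺ zero    = ≤-refl
bernoulli⁺ (suc j) = begin
  54 * u * (2 + suc j)       ≡⟨ eq₁ 54 u j ⟩
  54 * (u * (2 + j)) + 54 * u
    ≤⟨ +-mono-≤ (*-monoʳ-≤ 54 (bernoulli⁺ j)) (*-monoʳ-≤ 54 (^-monoˡ-≤ j (from-yes (54 ≤? 81)))) ⟩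
  54 * (2 * v) + 54 * v      ≡⟨ eq₂ v ⟩
  2 * (81 * v)               ∎
  where
  open ≤-Reasoning
  u = 54 ^ j
  v = 81 ^ j
  eq₁ : ∀ c u j → c * u * (2 + suc j) ≡ c * (u * (2 + j)) + c * u
  eq₁ = solve-∀
  eq₂ : ∀ v → 54 * (2 * v) + 54 * v ≡ 2 * (81 * v)
  eq₂ = solve-∀

-- Since 16 · 81³ = 54⁴, one hit cancels exactly three misses. The normalised weight is therefore
-- (3/2) to the power m - 3k, which is 1 precisely at hit density 1/4.
weight-balanced : ∀ k j → 16 ^ k * 81 ^ (3 * k + j) ≡ 54 ^ (4 * k) * 81 ^ j
weight-balanced k j = begin
  16 ^ k * 81 ^ (3 * k + j)         ≡⟨ cong (16 ^ k *_) (^-distribˡ-+-* 81 (3 * k) j) ⟩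
  16 ^ k * (81 ^ (3 * k) * 81 ^ j)  ≡⟨ *-assoc (16 ^ k) _ _ ⟨
  16 ^ k * 81 ^ (3 * k) * 81 ^ j    ≡⟨ cong (λ v → 16 ^ k * v * 81 ^ j) (sym (^-*-assoc 81 3 k)) ⟩
  16 ^ k * (81 ^ 3) ^ k * 81 ^ j    ≡⟨ cong (_* 81 ^ j) (sym (^-*-distrib 16 (81 ^ 3) k)) ⟩
  (54 ^ 4) ^ k * 81 ^ j             ≡⟨ cong (_* 81 ^ j) (^-*-assoc 54 4 k) ⟩
  54 ^ (4 * k) * 81 ^ j             ∎
  where open ≡-Reasoning

-- Bernoulli's inequality (3/2)ᵉ ≥ 1 + e/2 for e = m − 3k, multiplied out.
bernoulli : ∀ k m → 54 ^ (k + m) * (2 + (k + m)) ≤ 2 * (16 ^ k * 81 ^ m) + 54 ^ (k + m) * (4 * k)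
bernoulli k m with 3 * k ≤? m
... | yes 3k≤m with j , refl ← m≤n⇒∃[o]m+o≡n 3k≤m = begin
  54 ^ (k + (3 * k + j)) * (2 + (k + (3 * k + j)))  ≡⟨ cong₂ (λ d e → 54 ^ d * (2 + e)) d≡ d≡ ⟩
  54 ^ (4 * k + j) * (2 + (4 * k + j))          ≡⟨ cong (_* (2 + (4 * k + j))) split ⟩
  u * v * (2 + (4 * k + j))                     ≡⟨ eq₁ u v (4 * k) j ⟩
  u * (v * (2 + j)) + u * v * (4 * k)           ≤⟨ +-monoˡ-≤ _ (*-monoʳ-≤ u (bernoulli⁺ j)) ⟩
  u * (2 * 81 ^ j) + u * v * (4 * k)
    ≡⟨ cong₂ _+_ (eq₂ u (81 ^ j)) (cong (_* (4 * k)) (sym split)) ⟩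
  2 * (u * 81 ^ j) + 54 ^ (4 * k + j) * (4 * k)
    ≡⟨ cong₂ (λ w d → 2 * w + 54 ^ d * (4 * k)) (weight-balanced k j) d≡ ⟨
  2 * (16 ^ k * 81 ^ (3 * k + j)) + 54 ^ (k + (3 * k + j)) * (4 * k) ∎
  where
  open ≤-Reasoning
  u = 54 ^ (4 * k)
  v = 54 ^ j
  d≡ : k + (3 * k + j) ≡ 4 * k + j
  d≡ = sym (+-assoc k (3 * k) j)
  split : 54 ^ (4 * k + j) ≡ u * v
  split = ^-distribˡ-+-* 54 (4 * k) j
  eq₁ : ∀ u v c j → u * v * (2 + (c + j)) ≡ u * (v * (2 + j)) + u * v * c
  eq₁ = solve-∀
  eq₂ : ∀ u w → u * (2 * w) ≡ 2 * (u * w)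
  eq₂ = solve-∀
... | no 3k≰m with suc m ℕ.≟ 3 * k
-- Here e ≤ -2, so 1 + e/2 is not positive and nothing has to be shown. The only negative exponent
-- with content is e = -1, where 2/3 ≥ 1/2.
...   | no 1+m≢3k = ≤-trans (*-monoʳ-≤ (54 ^ (k + m)) d≤) (m≤n+m _ _)
  where
  d≤ : 2 + (k + m) ≤ 4 * k
  d≤ = subst (_≤ 4 * k) (eq k m) (+-monoʳ-≤ k (≤∧≢⇒< (≰⇒> 3k≰m) 1+m≢3k))
    where
    eq : ∀ k m → k + suc (suc m) ≡ 2 + (k + m)
    eq = solve-∀
...   | yes 1+m≡3k = begin
  u * (2 + d)               ≡⟨ eq₁ u d ⟩
  u + u * suc d             ≤⟨ +-mono-≤ u≤2w (≤-reflexive (cong (u *_) 1+d≡4k)) ⟩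
  2 * w + u * (4 * k)       ∎
  where
  open ≤-Reasoning
  d = k + m
  u = 54 ^ d
  w = 16 ^ k * 81 ^ m
  1+d≡4k : suc d ≡ 4 * k
  1+d≡4k = trans (sym (+-suc k m)) (cong (k +_) 1+m≡3k)
  eq₁ : ∀ u d → u * (2 + d) ≡ u + u * suc d
  eq₁ = solve-∀
  81w≡54u : 81 * w ≡ 54 * u
  81w≡54u = begin-equality
    81 * (16 ^ k * 81 ^ m)   ≡⟨ eq₂ 81 (16 ^ k) (81 ^ m) ⟩
    16 ^ k * 81 ^ suc m      ≡⟨ cong (λ e → 16 ^ k * 81 ^ e) (trans 1+m≡3k (sym (+-identityʳ _))) ⟩
    16 ^ k * 81 ^ (3 * k + 0) ≡⟨ weight-balanced k 0 ⟩
    54 ^ (4 * k) * 1         ≡⟨ *-identityʳ _ ⟩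
    54 ^ (4 * k)             ≡⟨ cong (54 ^_) 1+d≡4k ⟨
    54 * u                   ∎
    where
    eq₂ : ∀ a b c → a * (b * c) ≡ b * (a * c)
    eq₂ = solve-∀
  u≤2w : u ≤ 2 * w
  u≤2w = *-cancelˡ-≤ 81 (begin
    81 * u        ≤⟨ *-monoˡ-≤ u (from-yes (81 ≤? 108)) ⟩
    108 * u       ≡⟨ *-assoc 2 54 u ⟩
    2 * (54 * u)  ≡⟨ cong (2 *_) 81w≡54u ⟨
    2 * (81 * w)  ≡⟨ eq₃ w ⟩
    81 * (2 * w)  ∎)
    where
    eq₃ : ∀ w → 2 * (81 * w) ≡ 81 * (2 * w)
    eq₃ = solve-∀

-- A minorant of the exponential weight that is linear in the number of hits: its sum over a family
-- depends only on the average number of hits.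
weight-linear : ∀ {n} q (D x : Subset n) →
                54 ^ ∣ D ∣ * (2 + ∣ D ∣) ≤ 2 * weight q D x + 54 ^ ∣ D ∣ * (4 * hits q D x)
weight-linear q D x with m , k+m≡d , w≡ ← weight≡ q D x =
  subst₂ (λ d w → 54 ^ d * (2 + d) ≤ 2 * w + 54 ^ d * (4 * hits q D x)) k+m≡d (sym w≡)
    (bernoulli (hits q D x) m)

-- The coordinates are independent and each point of W ∩ D contributes the average of 16 and 81.
-- Against 54 this average is 97/108, the gain per point.
∑-weight : ∀ {n} q (W D : Subset n) →
           2 ^ ∣ W ∩ D ∣ * (∑[ x ∈ below W ] weight q (W ∩ D) x) ≡ 97 ^ ∣ W ∩ D ∣ * 2 ^ ∣ W ∣
∑-weight q [] [] = refl
∑-weight q (false ∷ W) (_ ∷ D) =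
  trans (cong (2 ^ ∣ W ∩ D ∣ *_) (∑-map (false ∷_) (below W) _)) (∑-weight q W D)
∑-weight q (true ∷ W) (false ∷ D) = begin
  a * ∑ (below (true ∷ W)) (weight q (false ∷ W ∩ D)) ≡⟨ cong (a *_) (∑-below-true W _) ⟩
  a * (s + s)                                  ≡⟨ eq a s ⟩
  2 * (a * s)                                  ≡⟨ cong (2 *_) (∑-weight q W D) ⟩
  2 * (97 ^ ∣ W ∩ D ∣ * 2 ^ ∣ W ∣)             ≡⟨ eq′ (97 ^ ∣ W ∩ D ∣) (2 ^ ∣ W ∣) ⟩
  97 ^ ∣ W ∩ D ∣ * (2 * 2 ^ ∣ W ∣)             ∎
  where
  open ≡-Reasoning
  a = 2 ^ ∣ W ∩ D ∣
  s = ∑[ x ∈ below W ] weight q (W ∩ D) x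
  eq : ∀ a s → a * (s + s) ≡ 2 * (a * s)
  eq = solve-∀
  eq′ : ∀ a s → 2 * (a * s) ≡ a * (2 * s)
  eq′ = solve-∀
∑-weight q (true ∷ W) (true ∷ D) = begin
  2 * a * ∑ (below (true ∷ W)) (weight q (true ∷ W ∩ D))
    ≡⟨ cong (2 * a *_) (trans (∑-below-true W _) (cong₂ _+_ (∑-*ˡ (below W) (c false) _) (∑-*ˡ (below W) (c true) _))) ⟩
  2 * a * (c false * s + c true * s)           ≡⟨ cong (2 * a *_) (sym (*-distribʳ-+ s (c false) (c true))) ⟩
  2 * a * ((c false + c true) * s)
    ≡⟨ cong (λ z → 2 * a * (z * s)) {c false + c true} {97} (c-sum q) ⟩
  2 * a * (97 * s)                             ≡⟨ eq a s 97 ⟩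
  2 * 97 * (a * s)                             ≡⟨ cong (2 * 97 *_) (∑-weight q W D) ⟩
  2 * 97 * (97 ^ ∣ W ∩ D ∣ * 2 ^ ∣ W ∣)        ≡⟨ eq′ (97 ^ ∣ W ∩ D ∣) (2 ^ ∣ W ∣) 97 ⟩
  97 * 97 ^ ∣ W ∩ D ∣ * (2 * 2 ^ ∣ W ∣)        ∎
  where
  open ≡-Reasoning
  a = 2 ^ ∣ W ∩ D ∣
  s = ∑[ x ∈ below W ] weight q (W ∩ D) x
  c : Bool → ℕ
  c b = if q xor b then 16 else 81
  c-sum : ∀ q → (if q xor false then 16 else 81) + (if q xor true then 16 else 81) ≡ 97
  c-sum true  = refl
  c-sum false = refl
  eq : ∀ a s c → 2 * a * (c * s) ≡ 2 * c * (a * s)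
  eq = solve-∀
  eq′ : ∀ a s c → 2 * c * (a * s) ≡ c * a * (2 * s)
  eq′ = solve-∀

∣∷∣ : ∀ {n} b (p : Subset n) → 𝟙 b + ∣ p ∣ ≡ ∣ b ∷ p ∣
∣∷∣ true  p = refl
∣∷∣ false p = refl

∑-lookup : ∀ {n} (W : Subset n) → ∑[ i ∈ allFin n ] 𝟙 (lookup W i) ≡ ∣ W ∣
∑-lookup []              = refl
∑-lookup {suc n} (b ∷ W) =
  trans (∑-allFin-suc n _) (trans (cong (𝟙 b +_) (∑-lookup W)) (∣∷∣ b W))

∑-hits : ∀ {n} q (D x : Subset n) →
         ∑[ i ∈ allFin n ] 𝟙 (lookup D i) * 𝟙 (q xor lookup x i) ≡ hits q D x
∑-hits q [] [] = refl
∑-hits {suc n} q (d ∷ D) (b ∷ x) = trans (∑-allFin-suc n _)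
  (trans (cong₂ _+_ (sym (𝟙-∧ d (q xor b))) (∑-hits q D x)) (∣∷∣ (d ∧ (q xor b)) (D ∩ Vec.map (q xor_) x)))

module _ {n} (f : Subset n → Bool) (W : Subset n) where

  card : ℕ
  card = ∑[ x ∈ below W ] 𝟙 (f x)

  cardAt : Bool → Fin n → ℕ
  cardAt q i = ∑[ x ∈ below W ] 𝟙 (q xor lookup x i) * 𝟙 (f x)

  cardAt-split : ∀ i → cardAt false i + cardAt true i ≡ card
  cardAt-split i = trans (sym (∑-+ (below W) _ _)) (∑-cong (below W) λ x → eq (lookup x i) (𝟙 (f x)))
    where
    eq : ∀ b m → 𝟙 b * m + 𝟙 (not b) * m ≡ m
    eq true  m = trans (+-identityʳ (m + 0)) (+-identityʳ m)
    eq false m = +-identityʳ m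

  cardAt≤card : ∀ q i → cardAt q i ≤ card
  cardAt≤card q i = ∑-mono (below W) λ x → 𝟙*≤ (q xor lookup x i) (𝟙 (f x))

  ∑-cardAt : ∀ q D → ∑[ i ∈ allFin n ] 𝟙 (lookup D i) * cardAt q i ≡ ∑[ x ∈ below W ] hits q D x * 𝟙 (f x)
  ∑-cardAt q D = begin
    (∑[ i ∈ allFin n ] 𝟙 (lookup D i) * cardAt q i)
      ≡⟨ ∑-cong (allFin n) (λ i → sym (∑-*ˡ (below W) (𝟙 (lookup D i)) _)) ⟩
    (∑[ i ∈ allFin n ] ∑[ x ∈ below W ] 𝟙 (lookup D i) * (𝟙 (q xor lookup x i) * 𝟙 (f x)))
      ≡⟨ ∑-swap (allFin n) (below W) _ ⟩
    (∑[ x ∈ below W ] ∑[ i ∈ allFin n ] 𝟙 (lookup D i) * (𝟙 (q xor lookup x i) * 𝟙 (f x)))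
      ≡⟨ ∑-cong (below W) (λ x → trans
           (∑-cong (allFin n) λ i → sym (*-assoc (𝟙 (lookup D i)) (𝟙 (q xor lookup x i)) (𝟙 (f x))))
           (trans (∑-*ʳ (allFin n) (𝟙 (f x)) _) (cong (_* 𝟙 (f x)) (∑-hits q D x)))) ⟩
    (∑[ x ∈ below W ] hits q D x * 𝟙 (f x)) ∎
    where open ≡-Reasoning

  -- An exponential moment argument. As the members hit E with average density at most 1/4, the
  -- linear minorant gives them a total weight of at least 54 ^ d times their number, where d = ∣ E
  -- ∣. All subsets of W together weigh only (97/2) ^ d times 2 ^ ∣ W ∣.
  card-thin : ∀ q D → let E = W ∩ D in
              4 * (∑[ i ∈ allFin n ] 𝟙 (lookup E i) * cardAt q i) ≤ card * ∣ E ∣ →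
              108 ^ ∣ E ∣ * card ≤ 97 ^ ∣ E ∣ * 2 ^ ∣ W ∣
  card-thin q D few = begin
    108 ^ d * card                ≡⟨ cong (_* card) (^-*-distrib 2 54 d) ⟩
    2 ^ d * 54 ^ d * card         ≡⟨ *-assoc (2 ^ d) u card ⟩
    2 ^ d * (54 ^ d * card)       ≤⟨ *-monoʳ-≤ (2 ^ d) u*card≤s ⟩
    2 ^ d * s                     ≡⟨ ∑-weight q W D ⟩
    97 ^ d * 2 ^ ∣ W ∣            ∎
    where
    open ≤-Reasoning
    E = W ∩ D
    d = ∣ E ∣
    u = 54 ^ d
    s = ∑[ x ∈ below W ] weight q E x
    h = ∑[ x ∈ below W ] hits q E x * 𝟙 (f x)
    pointwise : ∀ x → u * (2 + d) * 𝟙 (f x) ≤ 2 * weight q E x + u * 4 * (hits q E x * 𝟙 (f x))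
    pointwise x with f x
    ... | false = subst (_≤ 2 * weight q E x + u * 4 * (hits q E x * 0)) (sym (*-zeroʳ (u * (2 + d)))) z≤n
    ... | true = subst₂ _≤_ (sym (*-identityʳ _)) (cong (2 * weight q E x +_) (eq u (hits q E x))) (weight-linear q E x)
      where
      eq : ∀ u h → u * (4 * h) ≡ u * 4 * (h * 1)
      eq = solve-∀
    total : 2 * (u * card) + u * (card * d) ≤ 2 * s + u * (card * d)
    total = begin
      2 * (u * card) + u * (card * d)   ≡⟨ eq u d card ⟩
      u * (2 + d) * card                ≡⟨ ∑-*ˡ (below W) (u * (2 + d)) (λ x → 𝟙 (f x)) ⟨
      (∑[ x ∈ below W ] u * (2 + d) * 𝟙 (f x)) ≤⟨ ∑-mono (below W) pointwise ⟩
      (∑[ x ∈ below W ] (2 * weight q E x + u * 4 * (hits q E x * 𝟙 (f x))))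
        ≡⟨ trans (∑-+ (below W) _ _) (cong₂ _+_ (∑-*ˡ (below W) 2 (weight q E)) (∑-*ˡ (below W) (u * 4) _)) ⟩
      2 * s + u * 4 * h                 ≡⟨ cong (2 * s +_) (*-assoc u 4 h) ⟩
      2 * s + u * (4 * h)
        ≤⟨ +-monoʳ-≤ (2 * s) (*-monoʳ-≤ u (≤-trans (≤-reflexive (cong (4 *_) (sym (∑-cardAt q E)))) few)) ⟩
      2 * s + u * (card * d)            ∎
      where
      eq : ∀ u d c → 2 * (u * c) + u * (c * d) ≡ u * (2 + d) * c
      eq = solve-∀
    u*card≤s : u * card ≤ s
    u*card≤s = *-cancelˡ-≤ 2 (+-cancelʳ-≤ (u * (card * d)) (2 * (u * card)) (2 * s) total)

-- For u members through a point and v around it, the point lies in fewer than a quarter of the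
-- members, the density required by `card-thin`. Where this fails, v ≤ 3 u lets the members around
-- the point be traded for those through it.
sparse : ℕ → ℕ → Bool
sparse u v = 3 * u <ᵇ v

module _ {n} (f : Subset n → Bool) (W : Subset n) where
  -- No member contains a point outside W, so such points are bad whenever the family is nonempty.
  -- Only W ∩ `bad` carries information.
  bad : Subset n
  bad = tabulate λ i → sparse (cardAt f W false i) (cardAt f W true i)

  private
    w = ∣ W ∣
    r = card f W
    B = bad
    d = ∣ W ∩ B ∣
    out = ∑[ i ∈ allFin n ] 𝟙 (lookup W i) * cardAt f W true i
    out-bad = ∑[ i ∈ allFin n ] 𝟙 (lookup (W ∩ B) i) * cardAt f W true i

  lookup-W∩bad : ∀ i → lookup (W ∩ bad) i ≡ lookup W i ∧ sparse (cardAt f W false i) (cardAt f W true i)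
  lookup-W∩bad i = trans (lookup-zipWith _∧_ i W bad) (cong (lookup W i ∧_) (lookup∘tabulate _ i))

  bad-few : 4 * (∑[ i ∈ allFin n ] 𝟙 (lookup (W ∩ B) i) * cardAt f W false i) ≤ r * d
  bad-few = begin
    4 * (∑[ i ∈ allFin n ] 𝟙 (lookup (W ∩ B) i) * cardAt f W false i) ≡⟨ ∑-*ˡ (allFin n) 4 _ ⟨
    (∑[ i ∈ allFin n ] 4 * (𝟙 (lookup (W ∩ B) i) * cardAt f W false i)) ≤⟨ ∑-mono (allFin n) pointwise ⟩
    (∑[ i ∈ allFin n ] r * 𝟙 (lookup (W ∩ B) i)) ≡⟨ ∑-*ˡ (allFin n) r _ ⟩
    r * (∑[ i ∈ allFin n ] 𝟙 (lookup (W ∩ B) i)) ≡⟨ cong (r *_) (∑-lookup (W ∩ B)) ⟩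
    r * d ∎
    where
    open ≤-Reasoning
    lemma : ∀ w u v → u + v ≡ r → 4 * (𝟙 (w ∧ sparse u v) * u) ≤ r * 𝟙 (w ∧ sparse u v)
    lemma false u v u+v≡r = z≤n
    lemma true u v u+v≡r with sparse u v in s
    ... | false = z≤n
    ... | true = begin
      4 * (u + 0)  ≡⟨ eq u ⟩
      u + 3 * u    ≤⟨ +-monoʳ-≤ u (<⇒≤ (<ᵇ⇒< (3 * u) v (subst T (sym s) _))) ⟩
      u + v        ≡⟨ u+v≡r ⟩
      r            ≡⟨ *-identityʳ r ⟨
      r * 1        ∎
      where
      eq : ∀ u → 4 * (u + 0) ≡ u + 3 * u
      eq = solve-∀
    pointwise : ∀ i → 4 * (𝟙 (lookup (W ∩ B) i) * cardAt f W false i) ≤ r * 𝟙 (lookup (W ∩ B) i)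
    pointwise i rewrite lookup-W∩bad i =
      lemma (lookup W i) _ _ (cardAt-split f W i)

  ∑-cardAt≤ : ∀ (D : Subset n) → ∑[ i ∈ allFin n ] 𝟙 (lookup D i) * cardAt f W true i ≤ ∣ D ∣ * r
  ∑-cardAt≤ D = ≤-trans
    (∑-mono (allFin n) λ i → *-monoʳ-≤ (𝟙 (lookup D i)) (cardAt≤card f W true i))
    (≤-reflexive (trans (∑-*ʳ (allFin n) r _) (cong (_* r) (∑-lookup D))))

  -- The threshold 318/320 per coordinate works because (159/160)¹⁶ > 97/108.
  module _ (thick : 318 ^ w ≤ r * 160 ^ w) where

    private
      clash : ∀ d → 108 ^ d * r ≤ 97 ^ d * 2 ^ w → 108 ^ d * 159 ^ w ≤ 97 ^ d * 160 ^ w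
      clash d thin = *-cancelˡ-≤ (2 ^ w) {{m^n≢0 2 w}} (begin
        2 ^ w * (108 ^ d * 159 ^ w)   ≡⟨ eq₁ (2 ^ w) (108 ^ d) (159 ^ w) ⟩
        108 ^ d * (2 ^ w * 159 ^ w)   ≡⟨ cong (108 ^ d *_) (^-*-distrib 2 159 w) ⟨
        108 ^ d * 318 ^ w             ≤⟨ *-monoʳ-≤ (108 ^ d) thick ⟩
        108 ^ d * (r * 160 ^ w)       ≡⟨ *-assoc (108 ^ d) r _ ⟨
        108 ^ d * r * 160 ^ w         ≤⟨ *-monoˡ-≤ (160 ^ w) thin ⟩
        97 ^ d * 2 ^ w * 160 ^ w      ≡⟨ eq₂ (97 ^ d) (2 ^ w) (160 ^ w) ⟩
        2 ^ w * (97 ^ d * 160 ^ w)    ∎)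
        where
        open ≤-Reasoning
        eq₁ : ∀ a b c → a * (b * c) ≡ b * (a * c)
        eq₁ = solve-∀
        eq₂ : ∀ a b c → a * b * c ≡ b * (a * c)
        eq₂ = solve-∀

    thick⇒few-bad : 16 * d ≤ w
    thick⇒few-bad with 16 * d ≤? w
    ... | yes p = p
    ... | no p with e , w+e≡16d ← m≤n⇒∃[o]m+o≡n (<⇒≤ (≰⇒> p)) = contradiction ineq (<⇒≱ apart)
      where
      open ≤-Reasoning
      instance
        d≢0 : NonZero d
        d≢0 = ≢-nonZero λ d≡0 → n≮0 (subst (w <_) (trans (cong (16 *_) d≡0) refl) (≰⇒> p))
      -- The exponent w < 16 d is padded to 16 d, which preserves the inequality because 159 ≤ 160.
      -- Then everything is a d-th power.
      ineq : (108 * 159 ^ 16) ^ d ≤ (97 * 160 ^ 16) ^ d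
      ineq = begin
        (108 * 159 ^ 16) ^ d            ≡⟨ ^-*-distrib 108 (159 ^ 16) d ⟩
        108 ^ d * (159 ^ 16) ^ d        ≡⟨ cong (108 ^ d *_) (^-*-assoc 159 16 d) ⟩
        108 ^ d * 159 ^ (16 * d)        ≡⟨ cong (λ k → 108 ^ d * 159 ^ k) w+e≡16d ⟨
        108 ^ d * 159 ^ (w + e)         ≡⟨ cong (108 ^ d *_) (^-distribˡ-+-* 159 w e) ⟩
        108 ^ d * (159 ^ w * 159 ^ e)   ≡⟨ *-assoc (108 ^ d) _ _ ⟨
        108 ^ d * 159 ^ w * 159 ^ e
          ≤⟨ *-mono-≤ (clash d (card-thin f W false B bad-few)) (^-monoˡ-≤ e (from-yes (159 ≤? 160))) ⟩
        97 ^ d * 160 ^ w * 160 ^ e      ≡⟨ *-assoc (97 ^ d) _ _ ⟩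
        97 ^ d * (160 ^ w * 160 ^ e)    ≡⟨ cong (97 ^ d *_) (^-distribˡ-+-* 160 w e) ⟨
        97 ^ d * 160 ^ (w + e)          ≡⟨ cong (λ k → 97 ^ d * 160 ^ k) w+e≡16d ⟩
        97 ^ d * 160 ^ (16 * d)         ≡⟨ cong (97 ^ d *_) (^-*-assoc 160 16 d) ⟨
        97 ^ d * (160 ^ 16) ^ d         ≡⟨ ^-*-distrib 97 (160 ^ 16) d ⟨
        (97 * 160 ^ 16) ^ d             ∎
      apart : (97 * 160 ^ 16) ^ d < (108 * 159 ^ 16) ^ d
      apart = ^-monoˡ-< d (from-yes (97 * 160 ^ 16 <? 108 * 159 ^ 16))

    -- Otherwise fewer than a quarter of the members avoid the average point of W, and `card-thin`
    -- for complements, on all of W, contradicts thickness.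
    thick⇒out-large : r * w ≤ 4 * out
    thick⇒out-large with r * w ≤? 4 * out
    ... | yes p = p
    ... | no p = contradiction (clash w thin) (<⇒≱ apart)
      where
      open ≤-Reasoning
      W∩⊤ : W ∩ ⊤ ≡ W
      W∩⊤ = ∩-identityʳ W
      thin : 108 ^ w * r ≤ 97 ^ w * 2 ^ w
      thin = subst (λ E → 4 * (∑[ i ∈ allFin n ] 𝟙 (lookup E i) * cardAt f W true i) ≤ r * ∣ E ∣ →
                          108 ^ ∣ E ∣ * r ≤ 97 ^ ∣ E ∣ * 2 ^ w)
                   W∩⊤ (card-thin f W true ⊤) (<⇒≤ (≰⇒> p))
      instance
        w≢0 : NonZero w
        w≢0 = ≢-nonZero λ w≡0 → n≮0 (subst (4 * out <_) (trans (cong (r *_) w≡0) (*-zeroʳ r)) (≰⇒> p))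
      apart : 97 ^ w * 160 ^ w < 108 ^ w * 159 ^ w
      apart = begin-strict
        97 ^ w * 160 ^ w   ≡⟨ ^-*-distrib 97 160 w ⟨
        (97 * 160) ^ w     <⟨ ^-monoˡ-< w (from-yes (97 * 160 <? 108 * 159)) ⟩
        (108 * 159) ^ w    ≡⟨ ^-*-distrib 108 159 w ⟩
        108 ^ w * 159 ^ w  ∎

    -- Each of the at most w/16 bad points is avoided by at most r members, whereas `out` is at
    -- least r w/4.
    thick⇒bad-minor : 4 * out-bad ≤ out
    thick⇒bad-minor = *-cancelˡ-≤ 4 (begin
      4 * (4 * out-bad)  ≤⟨ *-monoʳ-≤ 4 (*-monoʳ-≤ 4 (∑-cardAt≤ (W ∩ B))) ⟩
      4 * (4 * (d * r))  ≡⟨ eq d r ⟩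
      r * (16 * d)       ≤⟨ *-monoʳ-≤ r thick⇒few-bad ⟩
      r * w              ≤⟨ thick⇒out-large ⟩
      4 * out            ∎)
      where
      open ≤-Reasoning
      eq : ∀ d r → 4 * (4 * (d * r)) ≡ r * (16 * d)
      eq = solve-∀

  -- The additive term pays for families that are not thick: they have fewer than (318/160) ^ w
  -- members, each counted at most n times.
  bad-bound : 160 ^ w * (4 * out-bad) ≤ 160 ^ w * out + 4 * n * 318 ^ w
  bad-bound with 318 ^ w ≤? r * 160 ^ w
  ... | yes thick = ≤-trans (*-monoʳ-≤ (160 ^ w) (thick⇒bad-minor thick)) (m≤m+n _ _)
  ... | no thin = ≤-trans (begin
    160 ^ w * (4 * out-bad)   ≤⟨ *-monoʳ-≤ (160 ^ w) (*-monoʳ-≤ 4 (∑-cardAt≤ (W ∩ B))) ⟩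
    160 ^ w * (4 * (d * r))   ≡⟨ eq (160 ^ w) d r ⟩
    4 * d * (r * 160 ^ w)     ≤⟨ *-mono-≤ (*-monoʳ-≤ 4 (∣p∣≤n (W ∩ B))) (<⇒≤ (≰⇒> thin)) ⟩
    4 * n * 318 ^ w           ∎) (m≤n+m _ _)
    where
    open ≤-Reasoning
    eq : ∀ u d r → u * (4 * (d * r)) ≡ 4 * d * (r * u)
    eq = solve-∀

-- The corruption bound

cube : ∀ n → List (Subset n)
cube n = below ⊤

∑-cube-suc : ∀ n (f : Subset (suc n) → ℕ) →
             ∑ (cube (suc n)) f ≡ (∑[ x ∈ cube n ] f (false ∷ x)) + (∑[ x ∈ cube n ] f (true ∷ x))
∑-cube-suc n = ∑-below-true ⊤

length-cube : ∀ n → length (cube n) ≡ 2 ^ n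
length-cube zero    = refl
length-cube (suc n) = begin
  length (cube (suc n))                 ≡⟨ length≡∑1 (cube (suc n)) ⟩
  ∑[ x ∈ cube (suc n) ] 1               ≡⟨ ∑-cube-suc n (λ _ → 1) ⟩
  (∑[ x ∈ cube n ] 1) + (∑[ x ∈ cube n ] 1)
    ≡⟨ cong (λ k → k + k) (trans (sym (length≡∑1 (cube n))) (length-cube n)) ⟩
  2 ^ n + 2 ^ n                         ≡⟨ cong (2 ^ n +_) (sym (+-identityʳ _)) ⟩
  2 ^ suc n                             ∎
  where open ≡-Reasoning

∑-below-insert-false : ∀ {n} (W : Subset n) i f →
  ∑ (below (insertAt W i false)) f ≡ ∑[ x ∈ below W ] f (insertAt x i false)
∑-below-insert-false W           zero    f = ∑-map (false ∷_) (below W) f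
∑-below-insert-false (false ∷ W) (suc i) f =
  trans (∑-map (false ∷_) (below (insertAt W i false)) f)
    (trans (∑-below-insert-false W i (f ∘ (false ∷_))) (sym (∑-map (false ∷_) (below W) _)))
∑-below-insert-false (true ∷ W)  (suc i) f =
  trans (∑-below-true (insertAt W i false) f)
    (trans (cong₂ _+_ (∑-below-insert-false W i (f ∘ (false ∷_))) (∑-below-insert-false W i (f ∘ (true ∷_))))
      (sym (∑-below-true W _)))

∑-below-insert-true : ∀ {n} (W : Subset n) i f →
  ∑ (below (insertAt W i true)) f ≡
  (∑[ x ∈ below W ] f (insertAt x i false)) + (∑[ x ∈ below W ] f (insertAt x i true))
∑-below-insert-true W           zero    f = ∑-below-true W f
∑-below-insert-true (false ∷ W) (suc i) f =
  trans (∑-map (false ∷_) (below (insertAt W i true)) f)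
    (trans (∑-below-insert-true W i (f ∘ (false ∷_)))
      (sym (cong₂ _+_ (∑-map (false ∷_) (below W) _) (∑-map (false ∷_) (below W) _))))
∑-below-insert-true (true ∷ W)  (suc i) f =
  trans (∑-below-true (insertAt W i true) f)
    (trans (cong₂ _+_ (∑-below-insert-true W i (f ∘ (false ∷_))) (∑-below-insert-true W i (f ∘ (true ∷_))))
      (trans (shuffle (∑[ x ∈ below W ] f (false ∷ insertAt x i false)) _ _ _)
        (sym (cong₂ _+_ (∑-below-true W (λ x → f (insertAt x (suc i) false)))
                        (∑-below-true W (λ x → f (insertAt x (suc i) true)))))))
  where
  shuffle : ∀ a b c d → a + b + (c + d) ≡ a + c + (b + d)
  shuffle = solve-∀

insertAt-⊤ : ∀ {n} (i : Fin (suc n)) → insertAt ⊤ i true ≡ ⊤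
insertAt-⊤             zero    = refl
insertAt-⊤ {n = suc n} (suc i) = cong (true ∷_) (insertAt-⊤ i)

∑-cube-through : ∀ {n} (i : Fin (suc n)) (f : Subset (suc n) → ℕ) →
                 ∑[ W ∈ cube (suc n) ] 𝟙 (lookup W i) * f W ≡ ∑[ P ∈ cube n ] f (insertAt P i true)
∑-cube-through {n} i f = begin
  ∑ (below ⊤) h                   ≡⟨ cong (λ W → ∑ (below W) h) (insertAt-⊤ i) ⟨
  ∑ (below (insertAt ⊤ i true)) h ≡⟨ ∑-below-insert-true ⊤ i h ⟩
  (∑[ P ∈ cube n ] h (insertAt P i false)) + (∑[ P ∈ cube n ] h (insertAt P i true))
    ≡⟨ cong₂ _+_ (trans (∑-cong (cube n) λ P → cong (λ b → 𝟙 b * f (insertAt P i false)) (insertAt-lookup P i false)) (∑-zero (cube n)))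
                 (∑-cong (cube n) λ P → trans (cong (λ b → 𝟙 b * f (insertAt P i true)) (insertAt-lookup P i true)) (*-identityˡ _)) ⟩
  (∑[ P ∈ cube n ] f (insertAt P i true)) ∎
  where
  open ≡-Reasoning
  h : Subset (suc n) → ℕ
  h W = 𝟙 (lookup W i) * f W

∑-cube-∁ : ∀ n (f : Subset n → ℕ) → ∑[ P ∈ cube n ] f (∁ P) ≡ ∑[ P ∈ cube n ] f P
∑-cube-∁ zero    f = refl
∑-cube-∁ (suc n) f = trans (∑-cube-suc n (f ∘ ∁))
  (trans (+-comm (∑[ P ∈ cube n ] f (true ∷ ∁ P)) _)
    (trans (cong₂ _+_ (∑-cube-∁ n (f ∘ (false ∷_))) (∑-cube-∁ n (f ∘ (true ∷_)))) (sym (∑-cube-suc n f))))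

∁-involutive : ∀ {n} (P : Subset n) → ∁ (∁ P) ≡ P
∁-involutive []      = refl
∁-involutive (b ∷ P) = cong₂ _∷_ (Bool.not-involutive b) (∁-involutive P)

∣W∣+∣∁W∣ : ∀ {n} (W : Subset n) → ∣ W ∣ + ∣ ∁ W ∣ ≡ n
∣W∣+∣∁W∣ []          = refl
∣W∣+∣∁W∣ (true  ∷ W) = cong suc (∣W∣+∣∁W∣ W)
∣W∣+∣∁W∣ (false ∷ W) = trans (+-suc ∣ W ∣ ∣ ∁ W ∣) (cong suc (∣W∣+∣∁W∣ W))

card≤ : ∀ {n} (f : Subset n → Bool) W → card f W ≤ 2 ^ ∣ W ∣
card≤ f W = ≤-trans (∑-mono (below W) λ x → 𝟙≤1 (f x)) (≤-reflexive (size W))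
  where
  size : ∀ {n} (W : Subset n) → ∑[ x ∈ below W ] 1 ≡ 2 ^ ∣ W ∣
  size []          = refl
  size (false ∷ W) = trans (∑-map (false ∷_) (below W) _) (size W)
  size (true  ∷ W) = trans (∑-below-true W _)
    (trans (cong₂ _+_ (size W) (size W)) (cong (2 ^ ∣ W ∣ +_) (sym (+-identityʳ _))))

∑-cube-binomial : ∀ n a b → ∑[ W ∈ cube n ] a ^ ∣ ∁ W ∣ * b ^ ∣ W ∣ ≡ (a + b) ^ n
∑-cube-binomial zero    a b = refl
∑-cube-binomial (suc n) a b = begin
  (∑[ W ∈ cube (suc n) ] a ^ ∣ ∁ W ∣ * b ^ ∣ W ∣) ≡⟨ ∑-cube-suc n _ ⟩
  (∑[ W ∈ cube n ] a * a ^ ∣ ∁ W ∣ * b ^ ∣ W ∣) + (∑[ W ∈ cube n ] a ^ ∣ ∁ W ∣ * (b * b ^ ∣ W ∣))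
    ≡⟨ cong₂ _+_ (∑-cong (cube n) λ W → *-assoc a (a ^ ∣ ∁ W ∣) (b ^ ∣ W ∣)) (∑-cong (cube n) λ W → eq b (a ^ ∣ ∁ W ∣) (b ^ ∣ W ∣)) ⟩
  (∑[ W ∈ cube n ] a * (a ^ ∣ ∁ W ∣ * b ^ ∣ W ∣)) + (∑[ W ∈ cube n ] b * (a ^ ∣ ∁ W ∣ * b ^ ∣ W ∣))
    ≡⟨ cong₂ _+_ (∑-*ˡ (cube n) a _) (∑-*ˡ (cube n) b _) ⟩
  a * s + b * s     ≡⟨ *-distribʳ-+ s a b ⟨
  (a + b) * s       ≡⟨ cong ((a + b) *_) (∑-cube-binomial n a b) ⟩
  (a + b) ^ suc n   ∎
  where
  open ≡-Reasoning
  s = ∑[ W ∈ cube n ] a ^ ∣ ∁ W ∣ * b ^ ∣ W ∣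
  eq : ∀ b x y → x * (b * y) ≡ b * (x * y)
  eq = solve-∀

-- The traces of a uniform set on P and on its complement are independent and uniform. This makes
-- the two parties independent once i and P are fixed.
∑-cube-split : ∀ {n} (P : Subset n) (u v : Subset n → ℕ) →
               ∑[ a ∈ cube n ] u (P ∩ a) * v (∁ P ∩ a) ≡ ∑ (below P) u * ∑ (below (∁ P)) v
∑-cube-split [] u v = trans (+-identityʳ (u [] * v [])) (sym (cong₂ _*_ (+-identityʳ (u [])) (+-identityʳ (v []))))
∑-cube-split {suc n} (true ∷ P) u v = begin
  (∑[ a ∈ cube (suc n) ] u ((true ∷ P) ∩ a) * v (∁ (true ∷ P) ∩ a)) ≡⟨ ∑-cube-suc n _ ⟩
  (∑[ a ∈ cube n ] u (false ∷ P ∩ a) * v (false ∷ ∁ P ∩ a)) + (∑[ a ∈ cube n ] u (true ∷ P ∩ a) * v (false ∷ ∁ P ∩ a))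
    ≡⟨ cong₂ _+_ (∑-cube-split P (u ∘ (false ∷_)) (v ∘ (false ∷_))) (∑-cube-split P (u ∘ (true ∷_)) (v ∘ (false ∷_))) ⟩
  ∑ (below P) (u ∘ (false ∷_)) * s + ∑ (below P) (u ∘ (true ∷_)) * s
    ≡⟨ *-distribʳ-+ s (∑ (below P) (u ∘ (false ∷_))) _ ⟨
  (∑ (below P) (u ∘ (false ∷_)) + ∑ (below P) (u ∘ (true ∷_))) * s
    ≡⟨ cong₂ _*_ (∑-below-true P u) (∑-map (false ∷_) (below (∁ P)) v) ⟨
  ∑ (below (true ∷ P)) u * ∑ (below (false ∷ ∁ P)) v ∎
  where
  open ≡-Reasoning
  s = ∑ (below (∁ P)) (v ∘ (false ∷_))
∑-cube-split {suc n} (false ∷ P) u v = begin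
  (∑[ a ∈ cube (suc n) ] u ((false ∷ P) ∩ a) * v (∁ (false ∷ P) ∩ a)) ≡⟨ ∑-cube-suc n _ ⟩
  (∑[ a ∈ cube n ] u (false ∷ P ∩ a) * v (false ∷ ∁ P ∩ a)) + (∑[ a ∈ cube n ] u (false ∷ P ∩ a) * v (true ∷ ∁ P ∩ a))
    ≡⟨ cong₂ _+_ (∑-cube-split P (u ∘ (false ∷_)) (v ∘ (false ∷_))) (∑-cube-split P (u ∘ (false ∷_)) (v ∘ (true ∷_))) ⟩
  s * ∑ (below (∁ P)) (v ∘ (false ∷_)) + s * ∑ (below (∁ P)) (v ∘ (true ∷_))
    ≡⟨ *-distribˡ-+ s (∑ (below (∁ P)) (v ∘ (false ∷_))) _ ⟨
  s * (∑ (below (∁ P)) (v ∘ (false ∷_)) + ∑ (below (∁ P)) (v ∘ (true ∷_)))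
    ≡⟨ cong₂ _*_ (∑-map (false ∷_) (below P) u) (∑-below-true (∁ P) v) ⟨
  ∑ (below (false ∷ P)) u * ∑ (below (true ∷ ∁ P)) v ∎
  where
  open ≡-Reasoning
  s = ∑ (below P) (u ∘ (false ∷_))

-- For b = false the pairs summed over are disjoint, for b = true they meet exactly in i.
∑-pairs : ∀ m → Bool → (Subset (suc m) → Subset (suc m) → ℕ) → ℕ
∑-pairs m b F = ∑[ i ∈ allFin (suc m) ] ∑[ P ∈ cube m ] ∑[ a ∈ cube m ]
  F (insertAt (P ∩ a) i b) (insertAt (∁ P ∩ a) i b)

module _ {m : ℕ} where

  slice : (Subset (suc m) → Bool) → Bool → Fin (suc m) → Subset m → ℕ
  slice f b i P = card (λ x → f (insertAt x i b)) P

  private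
    N = suc m
    is = allFin N

  cardAt-insert : ∀ f P i b → cardAt f (insertAt P i true) b i ≡ slice f (not b) i P
  cardAt-insert f P i b = begin
    cardAt f (insertAt P i true) b i                           ≡⟨ ∑-below-insert-true P i h ⟩
    (∑[ x ∈ below P ] h (insertAt x i false)) + (∑[ x ∈ below P ] h (insertAt x i true))
      ≡⟨ cong₂ _+_ (at false) (at true) ⟩
    𝟙 (b xor false) * slice f false i P + 𝟙 (b xor true) * slice f true i P ≡⟨ select b ⟩
    slice f (not b) i P                                        ∎
    where
    open ≡-Reasoning
    h : Subset N → ℕ
    h x = 𝟙 (b xor lookup x i) * 𝟙 (f x)
    at : ∀ c → ∑[ x ∈ below P ] h (insertAt x i c) ≡ 𝟙 (b xor c) * slice f c i P
    at c = trans (∑-cong (below P) λ x → cong (λ d → 𝟙 (b xor d) * 𝟙 (f (insertAt x i c))) (insertAt-lookup x i c))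
                 (∑-*ˡ (below P) (𝟙 (b xor c)) _)
    select : ∀ b → 𝟙 (b xor false) * slice f false i P + 𝟙 (b xor true) * slice f true i P ≡ slice f (not b) i P
    select true  = trans (+-identityʳ _) (+-identityʳ _)
    select false = +-identityʳ _

  card-insert : ∀ g P i → card g (insertAt P i false) ≡ slice g false i P
  card-insert g P i = ∑-below-insert-false P i (λ x → 𝟙 (g x))

  ∑-pairs-rectangle : ∀ b f g → ∑-pairs m b (λ x y → 𝟙 (f x) * 𝟙 (g y)) ≡
                      ∑[ i ∈ is ] ∑[ P ∈ cube m ] slice f b i P * slice g b i (∁ P)
  ∑-pairs-rectangle b f g = ∑-cong is λ i → ∑-cong (cube m) λ P →
    ∑-cube-split P (λ x → 𝟙 (f (insertAt x i b))) (λ y → 𝟙 (g (insertAt y i b)))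

  -- The mass of a rectangle on disjoint pairs, with the first party's factor filtered by φ, which
  -- is given the count through i and then the count around i. With `bad-part` only the share
  -- survives for which i is sparse.
  rect : (ℕ → ℕ → ℕ) → (f g : Subset N → Bool) → ℕ
  rect φ f g = ∑[ i ∈ is ] ∑[ P ∈ cube m ] φ (slice f true i P) (slice f false i P) * slice g false i (∁ P)

  -- Pairs (i, P) are regrouped by W = P ∪ {i}. The sets counted for g avoid i, hence lie in the
  -- complement of W, so their number leaves the inner sum, in which i runs through W as in
  -- `bad-bound`.
  rect-fibres : ∀ φ f g → rect φ f g ≡
    ∑[ W ∈ cube N ] card g (∁ W) * (∑[ i ∈ is ] 𝟙 (lookup W i) * φ (cardAt f W false i) (cardAt f W true i))
  rect-fibres φ f g = sym (begin
    (∑[ W ∈ cube N ] card g (∁ W) * (∑[ i ∈ is ] 𝟙 (lookup W i) * φ (cardAt f W false i) (cardAt f W true i)))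
      ≡⟨ ∑-cong (cube N) (λ W → trans (sym (∑-*ˡ is (card g (∁ W)) _))
           (∑-cong is λ i → eq (card g (∁ W)) (𝟙 (lookup W i)) (φ (cardAt f W false i) (cardAt f W true i)))) ⟩
    (∑[ W ∈ cube N ] ∑[ i ∈ is ] 𝟙 (lookup W i) * (φ (cardAt f W false i) (cardAt f W true i) * card g (∁ W)))
      ≡⟨ ∑-swap (cube N) is _ ⟩
    (∑[ i ∈ is ] ∑[ W ∈ cube N ] 𝟙 (lookup W i) * (φ (cardAt f W false i) (cardAt f W true i) * card g (∁ W)))
      ≡⟨ ∑-cong is (λ i → ∑-cube-through i _) ⟩
    (∑[ i ∈ is ] ∑[ P ∈ cube m ] φ (cardAt f (insertAt P i true) false i) (cardAt f (insertAt P i true) true i) * card g (∁ (insertAt P i true)))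
      ≡⟨ ∑-cong is (λ i → ∑-cong (cube m) λ P →
           cong₂ _*_ (cong₂ φ (cardAt-insert f P i false) (cardAt-insert f P i true))
                     (trans (cong (card g) (map-insertAt not true P i)) (card-insert g (∁ P) i))) ⟩
    rect φ f g ∎)
    where
    open ≡-Reasoning
    eq : ∀ a b c → a * (b * c) ≡ b * (c * a)
    eq = solve-∀

  all-part bad-part : ℕ → ℕ → ℕ
  all-part u v = v
  bad-part u v = 𝟙 (sparse u v) * v

  rect-bad : ∀ f g → 160 ^ N * (4 * rect bad-part f g) ≤ 160 ^ N * rect all-part f g + 4 * N * 638 ^ N
  rect-bad f g = begin
    160 ^ N * (4 * rect bad-part f g)
      ≡⟨ cong (λ s → 160 ^ N * (4 * s)) (rect-fibres bad-part f g) ⟩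
    160 ^ N * (4 * (∑[ W ∈ cube N ] c W * β W))
      ≡⟨ trans (∑-*ˡ (cube N) (160 ^ N) _) (cong (160 ^ N *_) (∑-*ˡ (cube N) 4 _)) ⟨
    (∑[ W ∈ cube N ] 160 ^ N * (4 * (c W * β W)))
      ≤⟨ ∑-mono (cube N) fibre ⟩
    (∑[ W ∈ cube N ] (160 ^ N * (c W * α W) + 4 * N * (320 ^ ∣ ∁ W ∣ * 318 ^ ∣ W ∣)))
      ≡⟨ trans (∑-+ (cube N) _ _) (cong₂ _+_ (∑-*ˡ (cube N) (160 ^ N) _) (∑-*ˡ (cube N) (4 * N) _)) ⟩
    -- The family of g is bounded by all subsets of the complement of W. Each point thus costs 318
    -- inside W and 160 · 2 = 320 outside, and by the binomial formula the error sums to 638 ^ N.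
    160 ^ N * (∑[ W ∈ cube N ] c W * α W) + 4 * N * (∑[ W ∈ cube N ] 320 ^ ∣ ∁ W ∣ * 318 ^ ∣ W ∣)
      ≡⟨ cong₂ (λ s t → 160 ^ N * s + 4 * N * t) (sym (rect-fibres all-part f g)) (∑-cube-binomial N 320 318) ⟩
    160 ^ N * rect all-part f g + 4 * N * 638 ^ N ∎
    where
    open ≤-Reasoning
    c α β : Subset N → ℕ
    c W = card g (∁ W)
    α W = ∑[ i ∈ is ] 𝟙 (lookup W i) * cardAt f W true i
    β W = ∑[ i ∈ is ] 𝟙 (lookup W i) * bad-part (cardAt f W false i) (cardAt f W true i)
    β≡ : ∀ W → β W ≡ ∑[ i ∈ is ] 𝟙 (lookup (W ∩ bad f W) i) * cardAt f W true i
    β≡ W = ∑-cong is λ i → trans (sym (*-assoc (𝟙 (lookup W i)) _ _))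
      (cong (_* cardAt f W true i) (sym (trans (cong 𝟙 (lookup-W∩bad f W i)) (𝟙-∧ (lookup W i) _))))
    fibre : ∀ W → 160 ^ N * (4 * (c W * β W)) ≤ 160 ^ N * (c W * α W) + 4 * N * (320 ^ ∣ ∁ W ∣ * 318 ^ ∣ W ∣)
    fibre W = begin
      160 ^ N * (4 * (c W * β W))                 ≡⟨ cong (_* (4 * (c W * β W))) 160^N ⟩
      160 ^ w * 160 ^ z * (4 * (c W * β W))       ≡⟨ eq₁ (160 ^ w) (160 ^ z) (c W) (β W) ⟩
      160 ^ z * c W * (160 ^ w * (4 * β W))
        ≤⟨ *-monoʳ-≤ (160 ^ z * c W) (subst (λ s → 160 ^ w * (4 * s) ≤ 160 ^ w * α W + 4 * N * 318 ^ w) (sym (β≡ W)) (bad-bound f W)) ⟩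
      160 ^ z * c W * (160 ^ w * α W + 4 * N * 318 ^ w)
        ≡⟨ eq₂ (160 ^ z) (c W) (160 ^ w) (α W) (4 * N) (318 ^ w) ⟩
      160 ^ w * 160 ^ z * (c W * α W) + 4 * N * (160 ^ z * c W * 318 ^ w)
        ≤⟨ +-mono-≤ (≤-reflexive (cong (_* (c W * α W)) (sym 160^N)))
                    (*-monoʳ-≤ (4 * N) (*-monoˡ-≤ (318 ^ w) (≤-trans (*-monoʳ-≤ (160 ^ z) (card≤ g (∁ W))) (≤-reflexive (sym (^-*-distrib 160 2 z)))))) ⟩
      160 ^ N * (c W * α W) + 4 * N * (320 ^ z * 318 ^ w) ∎
      where
      w = ∣ W ∣
      z = ∣ ∁ W ∣
      160^N : 160 ^ N ≡ 160 ^ w * 160 ^ z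
      160^N = trans (cong (160 ^_) (sym (∣W∣+∣∁W∣ W))) (^-distribˡ-+-* 160 w z)
      eq₁ : ∀ a b c d → a * b * (4 * (c * d)) ≡ b * c * (a * (4 * d))
      eq₁ = solve-∀
      eq₂ : ∀ b c a d n e → b * c * (a * d + n * e) ≡ a * b * (c * d) + n * (b * c * e)
      eq₂ = solve-∀

  -- Replacing P by its complement exchanges the parties.
  rect-flip : ∀ φ f g → ∑[ i ∈ is ] ∑[ P ∈ cube m ] slice f false i P * φ (slice g true i (∁ P)) (slice g false i (∁ P)) ≡ rect φ g f
  rect-flip φ f g = ∑-cong is λ i → trans (sym (∑-cube-∁ m _)) (∑-cong (cube m) λ P →
    trans (cong (λ Q → slice f false i (∁ P) * φ (slice g true i Q) (slice g false i Q)) (∁-involutive P))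
          (*-comm (slice f false i (∁ P)) _))

  -- Where i is sparse for neither family, v ≤ 3 u on both sides costs a factor 9. The two sparse
  -- shares take at most a quarter of the disjoint mass each, up to the error. Half of it remains,
  -- so the factor becomes 18.
  corruption : ∀ f g → let F = λ x y → 𝟙 (f x) * 𝟙 (g y) in
    160 ^ N * ∑-pairs m false F ≤ 18 * (160 ^ N * ∑-pairs m true F) + 4 * N * 638 ^ N
  corruption f g = subst₂ (λ s t → u * s ≤ 18 * (u * t) + err) (sym (∑-pairs-rectangle false f g)) (sym (∑-pairs-rectangle true f g))
    (*-cancelˡ-≤ 2 (+-cancelʳ-≤ (2 * (u * M₀)) _ _ (begin
      2 * (u * M₀) + 2 * (u * M₀)           ≡⟨ eq₁ u M₀ ⟩
      u * 4 * M₀                            ≤⟨ *-monoʳ-≤ (u * 4) M₀≤ ⟩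
      u * 4 * (9 * M₁ + X + Y)              ≡⟨ eq₂ u M₁ X Y ⟩
      36 * (u * M₁) + u * (4 * X) + u * (4 * Y)
        ≤⟨ +-mono-≤ (+-monoʳ-≤ (36 * (u * M₁)) (rect-bad f g)) (rect-bad g f) ⟩
      36 * (u * M₁) + (u * M₀ + err) + (u * rect all-part g f + err)
        ≡⟨ cong (λ s → 36 * (u * M₁) + (u * M₀ + err) + (u * s + err)) (sym (rect-flip all-part f g)) ⟩
      36 * (u * M₁) + (u * M₀ + err) + (u * M₀ + err) ≡⟨ eq₃ (u * M₁) (u * M₀) err ⟩
      2 * (18 * (u * M₁) + err) + 2 * (u * M₀) ∎)))
    where
    open ≤-Reasoning
    u = 160 ^ N
    err = 4 * N * 638 ^ N
    M₀ = ∑[ i ∈ is ] ∑[ P ∈ cube m ] slice f false i P * slice g false i (∁ P)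
    M₁ = ∑[ i ∈ is ] ∑[ P ∈ cube m ] slice f true i P * slice g true i (∁ P)
    X = rect bad-part f g
    Y = rect bad-part g f
    pointwise : ∀ u v u′ v′ → v * v′ ≤ 9 * (u * u′) + bad-part u v * v′ + v * bad-part u′ v′
    pointwise u v u′ v′ with 3 * u <ᵇ v in s | 3 * u′ <ᵇ v′ in s′
    ... | true | _ = ≤-trans (≤-reflexive (cong (_* v′) (sym (+-identityʳ v)))) (≤-trans (m≤n+m _ (9 * (u * u′))) (m≤m+n _ _))
    ... | false | true = ≤-trans (≤-reflexive (cong (v *_) (sym (+-identityʳ v′)))) (m≤n+m _ _)
    ... | false | false = ≤-trans (*-mono-≤ {v} {3 * u} {v′} {3 * u′} (≮⇒≥ λ p → subst T s (<⇒<ᵇ p)) (≮⇒≥ λ p → subst T s′ (<⇒<ᵇ p)))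
                            (≤-reflexive (eq u u′ v))
      where
      eq : ∀ u u′ v → 3 * u * (3 * u′) ≡ 9 * (u * u′) + 0 + v * 0
      eq = solve-∀
    M₀≤ : M₀ ≤ 9 * M₁ + X + Y
    M₀≤ = begin
      M₀
        ≤⟨ ∑-mono is (λ i → ∑-mono (cube m) λ P → pointwise (slice f true i P) (slice f false i P) (slice g true i (∁ P)) (slice g false i (∁ P))) ⟩
      (∑[ i ∈ is ] ∑[ P ∈ cube m ] (9 * A i P + B i P + C i P))
        ≡⟨ ∑-cong is (λ i → trans (∑-+ (cube m) _ (C i)) (cong (_+ ∑ (cube m) (C i)) (∑-+ (cube m) _ (B i)))) ⟩
      (∑[ i ∈ is ] ((∑[ P ∈ cube m ] 9 * A i P) + ∑ (cube m) (B i) + ∑ (cube m) (C i)))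
        ≡⟨ trans (∑-+ is (λ i → 9A i + ∑ (cube m) (B i)) (λ i → ∑ (cube m) (C i)))
                 (cong (_+ (∑[ i ∈ is ] ∑ (cube m) (C i))) (∑-+ is 9A (λ i → ∑ (cube m) (B i)))) ⟩
      (∑[ i ∈ is ] ∑[ P ∈ cube m ] 9 * A i P) + X + (∑[ i ∈ is ] ∑ (cube m) (C i))
        ≡⟨ cong₂ (λ s t → s + X + t) (trans (∑-cong is λ i → ∑-*ˡ (cube m) 9 (A i)) (∑-*ˡ is 9 (λ i → ∑ (cube m) (A i)))) (rect-flip bad-part f g) ⟩
      9 * M₁ + X + Y ∎
      where
      A B C : Fin N → Subset m → ℕ
      A i P = slice f true i P * slice g true i (∁ P)
      B i P = bad-part (slice f true i P) (slice f false i P) * slice g false i (∁ P)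
      9A : Fin N → ℕ
      9A i = ∑[ P ∈ cube m ] 9 * A i P
      C i P = slice f false i P * bad-part (slice g true i (∁ P)) (slice g false i (∁ P))
    eq₁ : ∀ u s → 2 * (u * s) + 2 * (u * s) ≡ u * 4 * s
    eq₁ = solve-∀
    eq₂ : ∀ u a b c → u * 4 * (9 * a + b + c) ≡ 36 * (u * a) + u * (4 * b) + u * (4 * c)
    eq₂ = solve-∀
    eq₃ : ∀ a b e → 36 * a + (b + e) + (b + e) ≡ 2 * (18 * a + e) + 2 * b
    eq₃ = solve-∀

-- Set disjointness

Rectangle : ℕ → Set
Rectangle n = (Subset n → Bool) × (Subset n → Bool)

module _ {n : ℕ} where

  value : Rectangle n → Subset n → Subset n → ℕ
  value (f , g) x y = 𝟙 (f x) * 𝟙 (g y)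

  cover : List (Rectangle n) → Subset n → Subset n → ℕ
  cover Rs x y = ∑[ R ∈ Rs ] value R x y

  _⊓ᴿ_ : Rectangle n → Rectangle n → Rectangle n
  (f , g) ⊓ᴿ (f′ , g′) = (λ x → f x ∧ f′ x) , (λ y → g y ∧ g′ y)

  value-⊓ᴿ : ∀ R S x y → value (R ⊓ᴿ S) x y ≡ value R x y * value S x y
  value-⊓ᴿ (f , g) (f′ , g′) x y =
    trans (cong₂ _*_ (𝟙-∧ (f x) (f′ x)) (𝟙-∧ (g y) (g′ y))) (eq (𝟙 (f x)) (𝟙 (f′ x)) (𝟙 (g y)) (𝟙 (g′ y)))
    where
    eq : ∀ a b c d → a * b * (c * d) ≡ a * c * (b * d)
    eq = solve-∀

  -- The counterpart of running a protocol k times with independent coins and accepting if all runs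
  -- accept.
  powers : ℕ → List (Rectangle n) → List (Rectangle n)
  powers zero    Rs = ((λ _ → true) , (λ _ → true)) ∷ []
  powers (suc k) Rs = concatMap (λ R → map (R ⊓ᴿ_) (powers k Rs)) Rs

  ∑-powers-suc : ∀ k Rs (h : Rectangle n → ℕ) →
                 ∑ (powers (suc k) Rs) h ≡ ∑[ R ∈ Rs ] ∑[ S ∈ powers k Rs ] h (R ⊓ᴿ S)
  ∑-powers-suc k Rs h = trans (∑-concatMap _ Rs h) (∑-cong Rs λ R → ∑-map (R ⊓ᴿ_) (powers k Rs) h)

  cover-powers : ∀ k Rs x y → cover (powers k Rs) x y ≡ cover Rs x y ^ k
  cover-powers zero    Rs x y = refl
  cover-powers (suc k) Rs x y = begin
    cover (powers (suc k) Rs) x y                                 ≡⟨ ∑-powers-suc k Rs _ ⟩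
    (∑[ R ∈ Rs ] ∑[ S ∈ powers k Rs ] value (R ⊓ᴿ S) x y)
      ≡⟨ ∑-cong Rs (λ R → trans (∑-cong (powers k Rs) λ S → value-⊓ᴿ R S x y) (∑-*ˡ (powers k Rs) (value R x y) _)) ⟩
    (∑[ R ∈ Rs ] value R x y * cover (powers k Rs) x y)            ≡⟨ ∑-*ʳ Rs (cover (powers k Rs) x y) _ ⟩
    cover Rs x y * cover (powers k Rs) x y
      ≡⟨ cong (cover Rs x y *_) (cover-powers k Rs x y) ⟩
    cover Rs x y ^ suc k                                          ∎
    where open ≡-Reasoning

  length-powers : ∀ k Rs → length (powers k Rs) ≡ length Rs ^ k
  length-powers zero    Rs = refl
  length-powers (suc k) Rs = begin
    length (powers (suc k) Rs)               ≡⟨ length≡∑1 (powers (suc k) Rs) ⟩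
    ∑[ _ ∈ powers (suc k) Rs ] 1             ≡⟨ ∑-powers-suc k Rs _ ⟩
    ∑[ _ ∈ Rs ] ∑[ _ ∈ powers k Rs ] 1       ≡⟨ ∑-const Rs _ ⟩
    length Rs * (∑[ _ ∈ powers k Rs ] 1)
      ≡⟨ cong (length Rs *_) (trans (sym (length≡∑1 (powers k Rs))) (length-powers k Rs)) ⟩
    length Rs ^ suc k                        ∎
    where open ≡-Reasoning

Meet : ∀ {n} → Subset n → Subset n → Set
Meet x y = ∃[ i ] lookup x i ≡ true × lookup y i ≡ true

split-disjoint : ∀ {m} (P a : Subset m) → ¬ Meet (P ∩ a) (∁ P ∩ a)
split-disjoint (true  ∷ P) (_ ∷ a) (zero  , _ , ())
split-disjoint (false ∷ P) (_ ∷ a) (zero  , () , _)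
split-disjoint (_ ∷ P)     (_ ∷ a) (suc j , x∋j , y∋j) = split-disjoint P a (j , x∋j , y∋j)

insert-false-disjoint : ∀ {m} (x y : Subset m) i → ¬ Meet x y → ¬ Meet (insertAt x i false) (insertAt y i false)
insert-false-disjoint x       y       zero    x⊥y (suc j , x∋j , y∋j) = x⊥y (j , x∋j , y∋j)
insert-false-disjoint (b ∷ x) (c ∷ y) (suc i) x⊥y (zero  , x∋j , y∋j) = x⊥y (zero , x∋j , y∋j)
insert-false-disjoint (b ∷ x) (c ∷ y) (suc i) x⊥y (suc j , x∋j , y∋j) =
  insert-false-disjoint x y i (λ { (k , x∋k , y∋k) → x⊥y (suc k , x∋k , y∋k) }) (j , x∋j , y∋j)

-- Used with a = 18, c = 3⁵ and a + b = 2⁵. Of the 2⁵ units that the disjoint pairs carry for each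
-- unit on the meeting pairs, a are explained by corruption; the remaining b = 14 must be covered by
-- the error, which forces many rectangles.
gap : ∀ {a b c L M₀ M₁} u p s q e .{{_ : NonZero s}} →
      u * M₀ ≤ a * (u * M₁) + L * e → p * ((a + b) * s) ≤ c * M₀ → c * M₁ ≤ p * s → L ≤ s * q →
      b * (u * p) ≤ c * (q * e)
gap {a} {b} {c} {L} {M₀} {M₁} u p s q e corrupt M₀≥ M₁≤ L≤ =
  *-cancelˡ-≤ s (+-cancelˡ-≤ (a * (u * (p * s))) _ _ (begin
    a * (u * (p * s)) + s * (b * (u * p)) ≡⟨ eq₁ a b u p s ⟩
    u * (p * ((a + b) * s))               ≤⟨ *-monoʳ-≤ u M₀≥ ⟩
    u * (c * M₀)                          ≡⟨ eq₂ u c M₀ ⟩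
    c * (u * M₀)                          ≤⟨ *-monoʳ-≤ c corrupt ⟩
    c * (a * (u * M₁) + L * e)            ≡⟨ eq₃ c a u M₁ (L * e) ⟩
    a * (u * (c * M₁)) + c * (L * e)
      ≤⟨ +-mono-≤ (*-monoʳ-≤ a (*-monoʳ-≤ u M₁≤)) (*-monoʳ-≤ c (*-monoˡ-≤ e L≤)) ⟩
    a * (u * (p * s)) + c * (s * q * e)   ≡⟨ cong (a * (u * (p * s)) +_) (eq₄ c s q e) ⟩
    a * (u * (p * s)) + s * (c * (q * e)) ∎))
  where
  open ≤-Reasoning
  eq₁ : ∀ a b u p s → a * (u * (p * s)) + s * (b * (u * p)) ≡ u * (p * ((a + b) * s))
  eq₁ = solve-∀
  eq₂ : ∀ u c s → u * (c * s) ≡ c * (u * s)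
  eq₂ = solve-∀
  eq₃ : ∀ c d u a b → c * (d * (u * a) + b) ≡ d * (u * (c * a)) + c * b
  eq₃ = solve-∀
  eq₄ : ∀ c s q e → c * (s * q * e) ≡ s * (c * (q * e))
  eq₄ = solve-∀

-- The factor 16 is the 4 of the error term times 4 for passing from 2 ^ m to 2 ^ N in both factors
-- of the number of pairs. With b = 14 and c = 3⁵, the least possible d is 278.
rescale : ∀ {b c d} n u t w v h q .{{_ : NonZero n}} .{{_ : NonZero t}} .{{_ : NonZero b}} →
          t * w ≡ u * (2 * h * (2 * h)) → c * 16 ≤ b * d →
          b * (u * (n * (h * h))) ≤ c * (q * (4 * n * (t * v))) → w ≤ d * (v * q)
rescale {b} {c} {d} n u t w v h q tw≡ 16c≤bd bound =
  *-cancelˡ-≤ (b * (n * t)) {{m*n≢0 b (n * t)}} (begin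
    b * (n * t) * w                       ≡⟨ eq₁ b n t w ⟩
    b * (n * (t * w))                     ≡⟨ cong (λ z → b * (n * z)) tw≡ ⟩
    b * (n * (u * (2 * h * (2 * h))))     ≡⟨ eq₂ b n u h ⟩
    4 * (b * (u * (n * (h * h))))         ≤⟨ *-monoʳ-≤ 4 bound ⟩
    4 * (c * (q * (4 * n * (t * v))))     ≡⟨ eq₃ c q n t v ⟩
    c * 16 * (n * t * (v * q))            ≤⟨ *-monoˡ-≤ (n * t * (v * q)) 16c≤bd ⟩
    b * d * (n * t * (v * q))             ≡⟨ eq₄ b d (n * t) (v * q) ⟩
    b * (n * t) * (d * (v * q))           ∎)
  where
  open ≤-Reasoning
  instance
    nt≢0 : NonZero (n * t)
    nt≢0 = m*n≢0 n t
  eq₁ : ∀ b n t w → b * (n * t) * w ≡ b * (n * (t * w))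
  eq₁ = solve-∀
  eq₂ : ∀ b n u h → b * (n * (u * (2 * h * (2 * h)))) ≡ 4 * (b * (u * (n * (h * h))))
  eq₂ = solve-∀
  eq₃ : ∀ c q n t v → 4 * (c * (q * (4 * n * (t * v)))) ≡ c * 16 * (n * t * (v * q))
  eq₃ = solve-∀
  eq₄ : ∀ b d x y → b * d * (x * y) ≡ b * x * (d * y)
  eq₄ = solve-∀

-- Every k factors gain a factor 2: j of these gains pay for c and e of them for 2 ^ e.
geometric-growth : ∀ {a b k c j e} n .{{_ : NonZero a}} → 2 * a ^ k ≤ b ^ k → a ≤ b → c < 2 ^ j →
                   k * (j + e) ≤ n → c * (a ^ n * 2 ^ e) < b ^ n
geometric-growth {a} {b} {k} {c} {j} {e} n doubling a≤b c<2ʲ kt≤n with r , kt+r≡n ← m≤n⇒∃[o]m+o≡n kt≤n =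
  begin-strict
    c * (a ^ n * 2 ^ e)              <⟨ *-monoˡ-< (a ^ n * 2 ^ e) c<2ʲ ⟩
    2 ^ j * (a ^ n * 2 ^ e)          ≡⟨ eq (2 ^ j) (a ^ n) (2 ^ e) ⟩
    2 ^ j * 2 ^ e * a ^ n            ≡⟨ cong₂ _*_ (sym (^-distribˡ-+-* 2 j e)) (split a) ⟩
    2 ^ t * ((a ^ k) ^ t * a ^ r)    ≡⟨ *-assoc (2 ^ t) ((a ^ k) ^ t) (a ^ r) ⟨
    2 ^ t * (a ^ k) ^ t * a ^ r      ≡⟨ cong (_* a ^ r) (^-*-distrib 2 (a ^ k) t) ⟨
    (2 * a ^ k) ^ t * a ^ r          ≤⟨ *-mono-≤ (^-monoˡ-≤ t doubling) (^-monoˡ-≤ r a≤b) ⟩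
    (b ^ k) ^ t * b ^ r              ≡⟨ split b ⟨
    b ^ n                            ∎
  where
  open ≤-Reasoning
  t = j + e
  instance
    aⁿ≢0 : NonZero (a ^ n)
    aⁿ≢0 = m^n≢0 a n
    2ᵉ≢0 : NonZero (2 ^ e)
    2ᵉ≢0 = m^n≢0 2 e
    aⁿ2ᵉ≢0 : NonZero (a ^ n * 2 ^ e)
    aⁿ2ᵉ≢0 = m*n≢0 (a ^ n) (2 ^ e)
  split : ∀ d → d ^ n ≡ (d ^ k) ^ t * d ^ r
  split d = trans (cong (d ^_) (sym kt+r≡n)) (trans (^-distribˡ-+-* d (k * t) r) (cong (_* d ^ r) (sym (^-*-assoc d k t))))
  eq : ∀ a b c → a * (b * c) ≡ a * c * b
  eq = solve-∀

module _ {m : ℕ} where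
  private
    N = suc m

  ∑-pairs-*ˡ : ∀ b c F → ∑-pairs m b (λ x y → c * F x y) ≡ c * ∑-pairs m b F
  ∑-pairs-*ˡ b c F =
    trans (∑-cong (allFin N) λ i → trans (∑-cong (cube m) λ P → ∑-*ˡ (cube m) c _) (∑-*ˡ (cube m) c _)) (∑-*ˡ (allFin N) c _)

  ∑-pairs-swap : ∀ b (Rs : List (Rectangle N)) → ∑-pairs m b (cover Rs) ≡ ∑[ R ∈ Rs ] ∑-pairs m b (value R)
  ∑-pairs-swap b Rs = trans
    (∑-cong (allFin N) λ i → trans (∑-cong (cube m) λ P → ∑-swap (cube m) Rs _) (∑-swap (cube m) Rs _))
    (∑-swap (allFin N) Rs _)

  #pairs : ℕ
  #pairs = N * (2 ^ m * 2 ^ m)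

  ∑-pairs-const : ∀ b c → ∑-pairs m b (λ _ _ → c) ≡ #pairs * c
  ∑-pairs-const b c = begin
    ∑-pairs m b (λ _ _ → c) ≡⟨ ∑-const (allFin N) _ ⟩
    length (allFin N) * (∑[ P ∈ cube m ] ∑[ a ∈ cube m ] c)
      ≡⟨ cong₂ _*_ (length-tabulate {n = N} id) (trans (∑-const (cube m) _) (cong₂ _*_ (length-cube m) (trans (∑-const (cube m) c) (cong (_* c) (length-cube m))))) ⟩
    N * (2 ^ m * (2 ^ m * c)) ≡⟨ eq N (2 ^ m) c ⟩
    #pairs * c ∎
    where
    open ≡-Reasoning
    eq : ∀ a b c → a * (b * (b * c)) ≡ a * (b * b) * c
    eq = solve-∀

  ∑-disjoint-≥ : ∀ F c v → (∀ x y → ¬ Meet x y → v ≤ c * F x y) → #pairs * v ≤ c * ∑-pairs m false F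
  ∑-disjoint-≥ F c v v≤cF = subst₂ _≤_ (∑-pairs-const false v) (∑-pairs-*ˡ false c F)
    (∑-mono (allFin N) λ i → ∑-mono (cube m) λ P → ∑-mono (cube m) λ a →
      v≤cF _ _ (insert-false-disjoint (P ∩ a) (∁ P ∩ a) i (split-disjoint P a)))

  ∑-meeting-≤ : ∀ F c v → (∀ x y → Meet x y → c * F x y ≤ v) → c * ∑-pairs m true F ≤ #pairs * v
  ∑-meeting-≤ F c v cF≤v = subst₂ _≤_ (∑-pairs-*ˡ true c F) (∑-pairs-const true v)
    (∑-mono (allFin N) λ i → ∑-mono (cube m) λ P → ∑-mono (cube m) λ a →
      cF≤v _ _ (i , insertAt-lookup (P ∩ a) i true , insertAt-lookup (∁ P ∩ a) i true))

  -- Corruption is additive over the list, but its error is incurred once per rectangle. This is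
  -- where the number of rectangles enters.
  corruption-cover : ∀ (Rs : List (Rectangle N)) →
    160 ^ N * ∑-pairs m false (cover Rs) ≤ 18 * (160 ^ N * ∑-pairs m true (cover Rs)) + length Rs * (4 * N * 638 ^ N)
  corruption-cover Rs = begin
    u * ∑-pairs m false (cover Rs)                           ≡⟨ cong (u *_) (∑-pairs-swap false Rs) ⟩
    u * (∑[ R ∈ Rs ] ∑-pairs m false (value R))              ≡⟨ ∑-*ˡ Rs u _ ⟨
    (∑[ R ∈ Rs ] u * ∑-pairs m false (value R))              ≤⟨ ∑-mono Rs (λ { (f , g) → corruption f g }) ⟩
    (∑[ R ∈ Rs ] (18 * (u * ∑-pairs m true (value R)) + 4 * N * 638 ^ N))
      ≡⟨ trans (∑-+ Rs _ _) (cong₂ _+_ (trans (∑-*ˡ Rs 18 _) (cong (18 *_) (∑-*ˡ Rs u _))) (∑-const Rs _)) ⟩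
    18 * (u * (∑[ R ∈ Rs ] ∑-pairs m true (value R))) + length Rs * (4 * N * 638 ^ N)
      ≡⟨ cong (λ s → 18 * (u * s) + length Rs * (4 * N * 638 ^ N)) (sym (∑-pairs-swap true Rs)) ⟩
    18 * (u * ∑-pairs m true (cover Rs)) + length Rs * (4 * N * 638 ^ N) ∎
    where
    open ≤-Reasoning
    u = 160 ^ N

  -- Passing to fifth powers of the acceptance counts turns the gap 2/3 against
  -- 1/3 into a factor 2⁵, which exceeds the factor 18 lost in corruption-cover.
  cover-large : ∀ (Rs : List (Rectangle N)) S Q .{{_ : NonZero S}} →
    (∀ x y → ¬ Meet x y → 2 * S ≤ 3 * cover Rs x y) →
    (∀ x y → Meet x y → 3 * cover Rs x y ≤ S) →
    length Rs ≤ S * Q → 320 ^ N ≤ 278 * (319 ^ N * Q ^ 5)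
  cover-large Rs S Q accept reject size =
    rescale {14} {3 ^ 5} {278} N (160 ^ N) (2 ^ N) (320 ^ N) (319 ^ N) (2 ^ m) (Q ^ 5)
      {{_}} {{m^n≢0 2 N}} 640^N (from-yes (3 ^ 5 * 16 ≤? 14 * 278))
      (subst (λ v → 14 * (160 ^ N * #pairs) ≤ 3 ^ 5 * (Q ^ 5 * (4 * N * v))) (^-*-distrib 2 319 N)
        (gap {18} {14} {3 ^ 5} (160 ^ N) #pairs (S ^ 5) (Q ^ 5) (4 * N * 638 ^ N)
          {{m^n≢0 S 5}} (corruption-cover Rs⁵) M₀≥ M₁≤ len≤))
    where
    Rs⁵ = powers 5 Rs
    M₀ M₁ : ℕ
    M₀ = ∑-pairs m false (cover Rs⁵)
    M₁ = ∑-pairs m true (cover Rs⁵)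
    cover⁵ : ∀ x y → 3 ^ 5 * cover Rs⁵ x y ≡ (3 * cover Rs x y) ^ 5
    cover⁵ x y = trans (cong (3 ^ 5 *_) (cover-powers 5 Rs x y)) (sym (^-*-distrib 3 (cover Rs x y) 5))
    M₀≥ : #pairs * (2 ^ 5 * S ^ 5) ≤ 3 ^ 5 * M₀
    M₀≥ = ∑-disjoint-≥ (cover Rs⁵) (3 ^ 5) (2 ^ 5 * S ^ 5) λ x y x⊥y →
      subst₂ _≤_ (^-*-distrib 2 S 5) (sym (cover⁵ x y)) (^-monoˡ-≤ 5 (accept x y x⊥y))
    M₁≤ : 3 ^ 5 * M₁ ≤ #pairs * S ^ 5
    M₁≤ = ∑-meeting-≤ (cover Rs⁵) (3 ^ 5) (S ^ 5) λ x y x∩y →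
      subst (_≤ S ^ 5) (sym (cover⁵ x y)) (^-monoˡ-≤ 5 (reject x y x∩y))
    len≤ : length Rs⁵ ≤ S ^ 5 * Q ^ 5
    len≤ = ≤-trans (≤-reflexive (length-powers 5 Rs)) (≤-trans (^-monoˡ-≤ 5 size) (≤-reflexive (^-*-distrib S Q 5)))
    640^N : 2 ^ N * 320 ^ N ≡ 160 ^ N * (2 * 2 ^ m * (2 * 2 ^ m))
    640^N = trans (sym (^-*-distrib 2 320 N)) (trans (^-*-distrib 160 4 N) (cong (160 ^ N *_) (^-*-distrib 2 2 N)))

  disjointness : ∀ (Rs : List (Rectangle N)) S e .{{_ : NonZero S}} →
    (∀ x y → ¬ Meet x y → 2 * S ≤ 3 * cover Rs x y) →
    (∀ x y → Meet x y → 3 * cover Rs x y ≤ S) →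
    length Rs ≤ S * 2 ^ e → N < 319 * (9 + e * 5)
  disjointness Rs S e accept reject size = ≰⇒> λ large →
    <⇒≱ (geometric-growth {319} {320} {319} {278} {9} {e * 5} N
           -- By Bernoulli, (1 + 1/319) to the power 319 is at least 2, so 319 coordinates suffice
           -- for a doubling.
           (from-yes (2 * 319 ^ 319 ≤? 320 ^ 319)) (from-yes (319 ≤? 320)) (from-yes (278 <? 2 ^ 9)) large)
        (subst (λ q → 320 ^ N ≤ 278 * (319 ^ N * q)) (^-*-assoc 2 e 5)
          (cover-large Rs S (2 ^ e) accept reject size))

-- Two-party simulation of CONGEST programs

-- This is 2 ^ (b + 1) - 1, the number of bit strings of length at most b: messages may be shorter
-- than their bound, and the length carries information too.
#codes : ℕ → ℕ
#codes zero    = 1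
#codes (suc b) = suc (#codes b + #codes b)

#codes≤ : ∀ b → #codes b ≤ 2 ^ suc b
#codes≤ b = <⇒≤ (≤-reflexive (exact b))
  where
  exact : ∀ b → suc (#codes b) ≡ 2 ^ suc b
  exact zero    = refl
  exact (suc b) = trans (cong suc (sym (+-suc (#codes b) (#codes b))))
    (trans (cong (λ k → k + k) (exact b)) (cong (2 ^ suc b +_) (sym (+-identityʳ _))))

encode : ∀ b → Vec≤ Bool b → Fin (#codes b)
encode zero    _                   = zero
encode (suc b) ([] Vec≤., _)            = zero
encode (suc b) ((false ∷ xs) Vec≤., l≤) = suc (encode b (xs Vec≤., s≤s⁻¹ l≤) ↑ˡ #codes b)
encode (suc b) ((true  ∷ xs) Vec≤., l≤) = suc (#codes b ↑ʳ encode b (xs Vec≤., s≤s⁻¹ l≤))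

decode : ∀ b → Fin (#codes b) → Vec≤ Bool b
decode zero    _       = [] Vec≤., z≤n
decode (suc b) zero    = [] Vec≤., z≤n
decode (suc b) (suc i) with splitAt (#codes b) i
... | inj₁ j = false Vec≤.∷ decode b j
... | inj₂ j = true Vec≤.∷ decode b j

decode-encode : ∀ b xs → decode b (encode b xs) ≡ xs
decode-encode zero    ([] Vec≤., _)            = refl
decode-encode (suc b) ([] Vec≤., _)            = refl
decode-encode (suc b) ((false ∷ xs) Vec≤., l≤)
  rewrite splitAt-↑ˡ (#codes b) (encode b (xs Vec≤., s≤s⁻¹ l≤)) (#codes b) =
  cong (false Vec≤.∷_) (decode-encode b (xs Vec≤., s≤s⁻¹ l≤))
decode-encode (suc b) ((true ∷ xs) Vec≤., l≤)
  rewrite splitAt-↑ʳ (#codes b) (#codes b) (encode b (xs Vec≤., s≤s⁻¹ l≤)) =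
  cong (true Vec≤.∷_) (decode-encode b (xs Vec≤., s≤s⁻¹ l≤))

funToFin-cong : ∀ {m n} {f g : Fin m → Fin n} → (∀ i → f i ≡ g i) → funToFin f ≡ funToFin g
funToFin-cong {zero}  f≗g = refl
funToFin-cong {suc m} f≗g = cong₂ combine (f≗g zero) (funToFin-cong (f≗g ∘ suc))

∑-allFin-select : ∀ {n} (k : Fin n) (p : Fin n → Bool) (h : Fin n → ℕ) →
                  p k ≡ true → (∀ i → p i ≡ true → i ≡ k) → ∑[ i ∈ allFin n ] 𝟙 (p i) * h i ≡ h k
∑-allFin-select {suc n} k p h pk uniq = trans (∑-allFin-suc n _) (go k pk uniq)
  where
  vanish : (∀ i → p (suc i) ≡ false) → ∑[ i ∈ allFin n ] 𝟙 (p (suc i)) * h (suc i) ≡ 0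
  vanish none = trans (∑-cong (allFin n) λ i → cong (λ b → 𝟙 b * h (suc i)) (none i)) (∑-zero (allFin n))
  go : ∀ k → p k ≡ true → (∀ i → p i ≡ true → i ≡ k) →
       𝟙 (p zero) * h zero + (∑[ i ∈ allFin n ] 𝟙 (p (suc i)) * h (suc i)) ≡ h k
  go zero pk uniq = trans (cong₂ _+_ (trans (cong (λ b → 𝟙 b * h zero) pk) (+-identityʳ (h zero)))
      (vanish λ i → Bool.¬-not λ pi → contradiction (uniq (suc i) pi) λ ()))
    (+-identityʳ (h zero))
  go (suc k) pk uniq = trans (cong (λ b → 𝟙 b * h zero + (∑[ i ∈ allFin n ] 𝟙 (p (suc i)) * h (suc i)))
      (Bool.¬-not λ p0 → contradiction (uniq zero p0) λ ()))
    (∑-allFin-select k (p ∘ suc) (h ∘ suc) pk λ i pi → Fin.suc-injective (uniq (suc i) pi))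

module _ {A : Set} (side : A → Bool) where

  own : ∀ {I : Set} → Bool → I → I → I
  own b x y = if b then y else x

  all-sides : ∀ (p q r : A → Bool) → (∀ v → side v ≡ false → p v ≡ r v) → (∀ v → side v ≡ true → q v ≡ r v) →
              ∀ vs → all (λ v → side v ∨ p v) vs ∧ all (λ v → not (side v) ∨ q v) vs ≡ all r vs
  all-sides p q r p≡r q≡r []       = refl
  all-sides p q r p≡r q≡r (v ∷ vs) with side v in eq
  ... | false = trans (Bool.∧-assoc (p v) _ _) (cong₂ _∧_ (p≡r v eq) (all-sides p q r p≡r q≡r vs))
  ... | true  = trans (swap (all (λ v → side v ∨ p v) vs) (q v) _) (cong₂ _∧_ (q≡r v eq) (all-sides p q r p≡r q≡r vs))
    where
    swap : ∀ a b c → a ∧ (b ∧ c) ≡ b ∧ (a ∧ c)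
    swap true  b c = refl
    swap false b c = sym (Bool.∧-zeroʳ b)

module _ {A : Set} (p : A → Bool) where

  all-tabulate⁻ : ∀ {n} (f : Fin n → A) → all p (List.tabulate f) ≡ true → ∀ i → p (f i) ≡ true
  all-tabulate⁻ f eq zero    = Bool.∧-conicalˡ (p (f zero)) _ eq
  all-tabulate⁻ f eq (suc i) = all-tabulate⁻ (f ∘ suc) (Bool.∧-conicalʳ (p (f zero)) _ eq) i

  all-tabulate⁺ : ∀ {n} (f : Fin n → A) → (∀ i → p (f i) ≡ true) → all p (List.tabulate f) ≡ true
  all-tabulate⁺ {zero}  f eq = refl
  all-tabulate⁺ {suc n} f eq = cong₂ _∧_ (eq zero) (all-tabulate⁺ (f ∘ suc) (eq ∘ suc))

module TwoParty (β γ : ℕ) {n : ℕ} (P : CONGEST.Program β γ n)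
  (ident : Fin n → CONGEST.ID β γ n) (ident-injective : Injective _≡_ _≡_ ident) where

  open CONGEST β γ
  open Program P

  #outcomes≢0 : NonZero (seeds ^ n)
  #outcomes≢0 = m^n≢0 seeds n

  network : Graph n → Network n
  network G = record { graph = G ; id = ident ; id-injective = ident-injective }

  module Run (G : Graph n) = Execution P (network G)

  -- Identifiers are injective, so the search can return only one vertex for `a`, whichever way it
  -- succeeds.
  neighbour-cong : ∀ {G H} v → (∀ u → adj G v u ≡ adj H v u) → ∀ a → Run.neighbour G v a ≡ Run.neighbour H v a
  neighbour-cong {G} {H} v G≡H a
    with any? (λ u → (adj G v u Bool.≟ true) ×-dec (ident u ≟ a)) | any? (λ u → (adj H v u Bool.≟ true) ×-dec (ident u ≟ a))
  ... | yes (u , _ , u≡a) | yes (u′ , _ , u′≡a) = cong just (ident-injective (trans u≡a (sym u′≡a)))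
  ... | yes (u , vu , u≡a) | no ∄u = contradiction (u , trans (sym (G≡H u)) vu , u≡a) ∄u
  ... | no ∄u | yes (u , vu , u≡a) = contradiction (u , trans (G≡H u) vu , u≡a) ∄u
  ... | no _ | no _ = refl

  neighbour-adj : ∀ G v a {u} → Run.neighbour G v a ≡ just u → adj G v u ≡ true
  neighbour-adj G v a eq with any? (λ u → (adj G v u Bool.≟ true) ×-dec (ident u ≟ a))
  neighbour-adj G v a refl | yes (u , vu , _) = vu

  step : Graph n → (Fin n → State) → Fin n → State
  step G σ v = receive (σ v) (Run.inbox G σ v)

  -- Unlike `stateAfter`, this peels off the first round, on whose messages the list of rectangles
  -- branches first.
  steps : Graph n → ℕ → (Fin n → State) → Fin n → State
  steps G zero    σ = σ
  steps G (suc t) σ = steps G t (step G σ)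

  steps-suc : ∀ G t σ → steps G t (step G σ) ≡ step G (steps G t σ)
  steps-suc G zero    σ = refl
  steps-suc G (suc t) σ = steps-suc G t (step G σ)

  stateAfter≡steps : ∀ G t ω → Run.stateAfter G t ω ≡ steps G t (Run.stateAfter G 0 ω)
  stateAfter≡steps G zero    ω = refl
  stateAfter≡steps G (suc t) ω = trans (cong (step G) (stateAfter≡steps G t ω)) (sym (steps-suc G t _))

  -- By `local` a node sees only the input of its own side. By `cut` it can have only its partner as
  -- a neighbour across, so one message per node describes all traffic between the parties in a
  -- round.
  module _ {N : ℕ} (G : Subset N → Subset N → Graph n) (side : Fin n → Bool) (partner : Fin n → Fin n)
    (local : ∀ x y v u → adj (G x y) v u ≡ adj (G (own side (side v) x y) (own side (side v) x y)) v u)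
    (cut : ∀ x y u v → adj (G x y) v u ≡ true → side u ≢ side v → v ≡ partner u) where

    private
      b = β * ⌈log₂ n ⌉
      K = #codes b

    Simulation : Set
    Simulation = Subset N → Fin n → State

    -- Both parties simulate all nodes, each as if its own input were both
    -- inputs; only the states of the nodes on its own side are meaningful.
    Coherent : Subset N → Subset N → Simulation → (Fin n → State) → Set
    Coherent x y s σ = ∀ v → σ v ≡ s (own side (side v) x y) v

    simStep : (Fin n → Message n) → Simulation → Simulation
    simStep m s z v = receive (s z v) (tabulate λ a →
      Maybe.map (λ u → if does (side u Bool.≟ side v) then send (s z u) (ident v) else m u) (Run.neighbour (G z z) v a))

    step-coherent : ∀ x y s σ m → Coherent x y s σ → (∀ u → m u ≡ send (σ u) (ident (partner u))) →
                    Coherent x y (simStep m s) (step (G x y) σ)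
    step-coherent x y s σ m coh m≡ v = cong₂ receive (coh v) (tabulate-cong message)
      where
      z = own side (side v) x y
      received : ∀ u → adj (G x y) v u ≡ true →
                 send (σ u) (ident v) ≡ (if does (side u Bool.≟ side v) then send (s z u) (ident v) else m u)
      received u vu with side u Bool.≟ side v
      ... | yes same = cong (λ τ → send τ (ident v)) (trans (coh u) (cong (λ c → s (own side c x y) u) same))
      ... | no other = trans (cong (send (σ u) ∘ ident) (cut x y u v vu other)) (sym (m≡ u))
      message : ∀ a → Maybe.map (λ u → send (σ u) (ident v)) (Run.neighbour (G x y) v a) ≡
                      Maybe.map (λ u → if does (side u Bool.≟ side v) then send (s z u) (ident v) else m u) (Run.neighbour (G z z) v a)
      message a with Run.neighbour (G x y) v a in eq | Run.neighbour (G z z) v a | neighbour-cong {G x y} {G z z} v (local x y v) a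
      ... | nothing | _ | refl = refl
      ... | just u  | _ | refl = cong just (received u (neighbour-adj (G x y) v a eq))

    agrees : Simulation → Fin (K ^ n) → Subset N → Fin n → Bool
    agrees s c z u = does (encode b (send (s z u) (ident (partner u))) ≟ finToFun c u)

    -- Each party checks the announced messages of its own nodes, from its own input. Hence
    -- consistency with an announcement is a rectangle.
    sends : Simulation → Fin (K ^ n) → Rectangle N
    sends s c = (λ x → all (λ u → side u ∨ agrees s c x u) (allFin n)) ,
                (λ y → all (λ u → not (side u) ∨ agrees s c y u) (allFin n))

    messages : Fin (K ^ n) → Fin n → Message n
    messages c u = decode b (finToFun c u)

    -- One rectangle per transcript. A message is announced for every node, even one without an edge
    -- across, which changes the exponent only by a constant factor.
    rectangles : ℕ → Simulation → List (Rectangle N)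
    rectangles zero    s = ((λ x → all (λ v → side v ∨ accepts (s x v)) (allFin n)) ,
                            (λ y → all (λ v → not (side v) ∨ accepts (s y v)) (allFin n))) ∷ []
    rectangles (suc t) s =
      concatMap (λ c → map (sends s c ⊓ᴿ_) (rectangles t (simStep (messages c) s))) (allFin (K ^ n))

    value-sides : ∀ x y (p : Subset N → Fin n → Bool) (r : Fin n → Bool) → (∀ v → p (own side (side v) x y) v ≡ r v) →
      value {N} ((λ x → all (λ v → side v ∨ p x v) (allFin n)) , (λ y → all (λ v → not (side v) ∨ p y v) (allFin n))) x y
      ≡ 𝟙 (all r (allFin n))
    value-sides x y p r p≡r = trans (sym (𝟙-∧ (all (λ v → side v ∨ p x v) (allFin n)) _)) (cong 𝟙
      (all-sides side (p x) (p y) r (λ v eq → subst (λ c → p (own side c x y) v ≡ r v) eq (p≡r v))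
                                    (λ v eq → subst (λ c → p (own side c x y) v ≡ r v) eq (p≡r v)) (allFin n)))

    -- In each round exactly one announcement agrees with the messages really sent. All other
    -- branches vanish at (x, y).
    cover-rectangles : ∀ x y t s σ → Coherent x y s σ →
      cover (rectangles t s) x y ≡ 𝟙 (all (λ v → accepts (steps (G x y) t σ v)) (allFin n))
    cover-rectangles x y zero    s σ coh = trans (+-identityʳ _)
      (value-sides x y (λ z v → accepts (s z v)) (accepts ∘ σ) λ v → cong accepts (sym (coh v)))
    cover-rectangles x y (suc t) s σ coh = begin
      cover (rectangles (suc t) s) x y
        ≡⟨ trans (∑-concatMap _ (allFin (K ^ n)) _) (∑-cong (allFin (K ^ n)) λ c → trans (∑-map (sends s c ⊓ᴿ_) (next c) _)
             (trans (∑-cong (next c) λ R → value-⊓ᴿ (sends s c) R x y) (∑-*ˡ (next c) (value (sends s c) x y) _))) ⟩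
      (∑[ c ∈ allFin (K ^ n) ] value (sends s c) x y * cover (next c) x y)
        ≡⟨ ∑-cong (allFin (K ^ n)) (λ c → cong (_* cover (next c) x y)
             (value-sides x y (agrees s c) (matches c) λ u → cong (λ τ → does (encode b (send τ (ident (partner u))) ≟ finToFun c u)) (sym (coh u)))) ⟩
      (∑[ c ∈ allFin (K ^ n) ] 𝟙 (all (matches c) (allFin n)) * cover (next c) x y)
        ≡⟨ ∑-allFin-select actual (λ c → all (matches c) (allFin n)) (λ c → cover (next c) x y) matches-actual matches⇒actual ⟩
      cover (next actual) x y
        ≡⟨ cover-rectangles x y t (simStep (messages actual) s) (step (G x y) σ)
             (step-coherent x y s σ (messages actual) coh λ u →
               trans (cong (decode b) (finToFun-funToFin code u)) (decode-encode b _)) ⟩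
      𝟙 (all (λ v → accepts (steps (G x y) (suc t) σ v)) (allFin n)) ∎
      where
      open ≡-Reasoning
      next : Fin (K ^ n) → List (Rectangle N)
      next c = rectangles t (simStep (messages c) s)
      code : Fin n → Fin K
      code u = encode b (send (σ u) (ident (partner u)))
      actual : Fin (K ^ n)
      actual = funToFin code
      matches : Fin (K ^ n) → Fin n → Bool
      matches c u = does (code u ≟ finToFun c u)
      matches-actual : all (matches actual) (allFin n) ≡ true
      matches-actual = all-tabulate⁺ (matches actual) id λ u →
        dec-true (code u ≟ finToFun actual u) (sym (finToFun-funToFin code u))
      matches⇒actual : ∀ c → all (matches c) (allFin n) ≡ true → c ≡ actual
      matches⇒actual c all≡true = trans (sym (funToFin-finToFin {n} {K} c)) (funToFin-cong λ u →
        sym (does⇒≡ (code u) (finToFun c u) (all-tabulate⁻ (matches c) id all≡true u)))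
        where
        does⇒≡ : ∀ {k} (i j : Fin k) → does (i ≟ j) ≡ true → i ≡ j
        does⇒≡ i j eq with i ≟ j
        ... | yes i≡j = i≡j

    length-rectangles : ∀ t s → length (rectangles t s) ≡ (K ^ n) ^ t
    length-rectangles zero    s = refl
    length-rectangles (suc t) s = begin
      length (rectangles (suc t) s)                 ≡⟨ length≡∑1 (rectangles (suc t) s) ⟩
      ∑[ _ ∈ rectangles (suc t) s ] 1               ≡⟨ ∑-concatMap _ (allFin (K ^ n)) _ ⟩
      ∑[ c ∈ allFin (K ^ n) ] ∑[ _ ∈ map (sends s c ⊓ᴿ_) (next c) ] 1
        ≡⟨ ∑-cong (allFin (K ^ n)) (λ c → trans (∑-map (sends s c ⊓ᴿ_) (next c) _)
             (trans (sym (length≡∑1 (next c))) (length-rectangles t (simStep (messages c) s)))) ⟩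
      ∑[ _ ∈ allFin (K ^ n) ] (K ^ n) ^ t           ≡⟨ ∑-const (allFin (K ^ n)) _ ⟩
      length (allFin (K ^ n)) * (K ^ n) ^ t
        ≡⟨ cong (_* (K ^ n) ^ t) (length-tabulate {n = K ^ n} id) ⟩
      (K ^ n) ^ suc t                               ∎
      where
      open ≡-Reasoning
      next : Fin (K ^ n) → List (Rectangle N)
      next c = rectangles t (simStep (messages c) s)

    start : Fin (seeds ^ n) → Simulation
    start ω z v = Run.stateAfter (G z z) 0 ω v

    start-coherent : ∀ x y ω → Coherent x y (start ω) (Run.stateAfter (G x y) 0 ω)
    start-coherent x y ω v = cong (λ nbrs → init (ident v) nbrs (finToFun ω v))
      (tabulate-cong λ a → cong is-just (neighbour-cong {G x y} v (local x y v) a))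

    -- The seeds serve as public coins: each outcome gives a deterministic protocol, and joining
    -- their lists makes the cover number count accepting outcomes.
    protocol : ℕ → List (Rectangle N)
    protocol t = concatMap (λ ω → rectangles t (start ω)) (allFin (seeds ^ n))

    cover-protocol : ∀ t x y → cover (protocol t) x y ≡ ∣ tabulate (Run.allAccept (G x y) t) ∣
    cover-protocol t x y = begin
      cover (protocol t) x y
        ≡⟨ ∑-concatMap _ (allFin (seeds ^ n)) _ ⟩
      (∑[ ω ∈ allFin (seeds ^ n) ] cover (rectangles t (start ω)) x y)
        ≡⟨ ∑-cong (allFin (seeds ^ n)) (λ ω → trans (cover-rectangles x y t (start ω) _ (start-coherent x y ω))
             (cong 𝟙 (sym (cong (λ σ → all (accepts ∘ σ) (allFin n)) (stateAfter≡steps (G x y) t ω))))) ⟩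
      (∑[ ω ∈ allFin (seeds ^ n) ] 𝟙 (Run.allAccept (G x y) t ω))
        ≡⟨ ∑-cong (allFin (seeds ^ n)) (λ ω → cong 𝟙 (sym (lookup∘tabulate (Run.allAccept (G x y) t) ω))) ⟩
      (∑[ ω ∈ allFin (seeds ^ n) ] 𝟙 (lookup (tabulate (Run.allAccept (G x y) t)) ω))
        ≡⟨ ∑-lookup (tabulate (Run.allAccept (G x y) t)) ⟩
      ∣ tabulate (Run.allAccept (G x y) t) ∣ ∎
      where open ≡-Reasoning

    length-protocol : ∀ t → length (protocol t) ≡ seeds ^ n * (K ^ n) ^ t
    length-protocol t = begin
      length (protocol t)                                                ≡⟨ length≡∑1 (protocol t) ⟩
      ∑[ _ ∈ protocol t ] 1
        ≡⟨ ∑-concatMap _ (allFin (seeds ^ n)) _ ⟩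
      ∑[ ω ∈ allFin (seeds ^ n) ] ∑[ _ ∈ rectangles t (start ω) ] 1
        ≡⟨ ∑-cong (allFin (seeds ^ n)) (λ ω → trans (sym (length≡∑1 (rectangles t (start ω)))) (length-rectangles t (start ω))) ⟩
      ∑[ ω ∈ allFin (seeds ^ n) ] (K ^ n) ^ t                            ≡⟨ ∑-const (allFin (seeds ^ n)) _ ⟩
      length (allFin (seeds ^ n)) * (K ^ n) ^ t
        ≡⟨ cong (_* (K ^ n) ^ t) (length-tabulate {n = seeds ^ n} id) ⟩
      seeds ^ n * (K ^ n) ^ t                                            ∎
      where open ≡-Reasoning

-- The lower-bound graphs

≟-true : ∀ {n} {i j : Fin n} → does (i ≟ j) ≡ true → i ≡ j
≟-true {i = i} {j} eq with i ≟ j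
... | yes i≡j = i≡j

module Gadget (s : ℕ) where

  Vertex : Set
  Vertex = Fin 5 × Fin s

  -- A blow-up of the 5-cycle: the classes 0 and 1 span the bipartite graph x and
  -- the classes 4 and 3 the bipartite graph y; the other three pairs of
  -- consecutive classes are joined by perfect matchings.
  arc : (x y : Subset (s * s)) → Vertex → Vertex → Bool
  arc x y (0F , i) (1F , j) = lookup x (combine i j)
  arc x y (1F , i) (2F , j) = does (i ≟ j)
  arc x y (2F , i) (3F , j) = does (i ≟ j)
  arc x y (3F , j) (4F , i) = lookup y (combine i j)
  arc x y (4F , i) (0F , j) = does (i ≟ j)
  arc x y _        _        = false

  edge : (x y : Subset (s * s)) → Vertex → Vertex → Bool
  edge x y p q = arc x y p q ∨ arc x y q p

  edge-irrefl : ∀ x y p → edge x y p p ≡ false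
  edge-irrefl x y (0F , i) = refl
  edge-irrefl x y (1F , i) = refl
  edge-irrefl x y (2F , i) = refl
  edge-irrefl x y (3F , i) = refl
  edge-irrefl x y (4F , i) = refl

  vertex : Fin (5 * s) → Vertex
  vertex = remQuot {5} s

  graph : (x y : Subset (s * s)) → Graph (5 * s)
  graph x y = record
    { adj    = λ u v → edge x y (vertex u) (vertex v)
    ; sym    = λ u v → Bool.∨-comm (arc x y (vertex u) (vertex v)) _
    ; irrefl = λ v → edge-irrefl x y (vertex v)
    }

  second : Vertex → Bool
  second (3F , _) = true
  second (4F , _) = true
  second _        = false

  -- Class 1 has no edge across; its value is a filler.
  opposite : Vertex → Vertex
  opposite (0F , i) = 4F , i
  opposite (1F , i) = 1F , i
  opposite (2F , i) = 3F , i
  opposite (3F , i) = 2F , i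
  opposite (4F , i) = 0F , i

  edge-local : ∀ x y p q → let z = own second (second p) x y in edge x y p q ≡ edge z z p q
  edge-local x y (0F , i) (0F , j) = refl
  edge-local x y (0F , i) (1F , j) = refl
  edge-local x y (0F , i) (2F , j) = refl
  edge-local x y (0F , i) (3F , j) = refl
  edge-local x y (0F , i) (4F , j) = refl
  edge-local x y (1F , i) (0F , j) = refl
  edge-local x y (1F , i) (1F , j) = refl
  edge-local x y (1F , i) (2F , j) = refl
  edge-local x y (1F , i) (3F , j) = refl
  edge-local x y (1F , i) (4F , j) = refl
  edge-local x y (2F , i) (0F , j) = refl
  edge-local x y (2F , i) (1F , j) = refl
  edge-local x y (2F , i) (2F , j) = refl
  edge-local x y (2F , i) (3F , j) = refl
  edge-local x y (2F , i) (4F , j) = refl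
  edge-local x y (3F , i) (0F , j) = refl
  edge-local x y (3F , i) (1F , j) = refl
  edge-local x y (3F , i) (2F , j) = refl
  edge-local x y (3F , i) (3F , j) = refl
  edge-local x y (3F , i) (4F , j) = refl
  edge-local x y (4F , i) (0F , j) = refl
  edge-local x y (4F , i) (1F , j) = refl
  edge-local x y (4F , i) (2F , j) = refl
  edge-local x y (4F , i) (3F , j) = refl
  edge-local x y (4F , i) (4F , j) = refl

  edge-cut : ∀ x y p q → edge x y p q ≡ true → second q ≢ second p → p ≡ opposite q
  edge-cut x y (0F , i) (0F , j) e q≢p = contradiction refl q≢p
  edge-cut x y (0F , i) (1F , j) e q≢p = contradiction refl q≢p
  edge-cut x y (0F , i) (2F , j) e q≢p = contradiction refl q≢p
  edge-cut x y (0F , i) (3F , j) () q≢p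
  edge-cut x y (0F , i) (4F , j) e q≢p = cong (0F ,_) (sym (≟-true e))
  edge-cut x y (1F , i) (0F , j) e q≢p = contradiction refl q≢p
  edge-cut x y (1F , i) (1F , j) e q≢p = contradiction refl q≢p
  edge-cut x y (1F , i) (2F , j) e q≢p = contradiction refl q≢p
  edge-cut x y (1F , i) (3F , j) () q≢p
  edge-cut x y (1F , i) (4F , j) () q≢p
  edge-cut x y (2F , i) (0F , j) e q≢p = contradiction refl q≢p
  edge-cut x y (2F , i) (1F , j) e q≢p = contradiction refl q≢p
  edge-cut x y (2F , i) (2F , j) e q≢p = contradiction refl q≢p
  edge-cut x y (2F , i) (3F , j) e q≢p = cong (2F ,_) (≟-true (trans (sym (Bool.∨-identityʳ _)) e))
  edge-cut x y (2F , i) (4F , j) () q≢p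
  edge-cut x y (3F , i) (0F , j) () q≢p
  edge-cut x y (3F , i) (1F , j) () q≢p
  edge-cut x y (3F , i) (2F , j) e q≢p = cong (3F ,_) (sym (≟-true e))
  edge-cut x y (3F , i) (3F , j) e q≢p = contradiction refl q≢p
  edge-cut x y (3F , i) (4F , j) e q≢p = contradiction refl q≢p
  edge-cut x y (4F , i) (0F , j) e q≢p = cong (4F ,_) (≟-true (trans (sym (Bool.∨-identityʳ _)) e))
  edge-cut x y (4F , i) (1F , j) () q≢p
  edge-cut x y (4F , i) (2F , j) () q≢p
  edge-cut x y (4F , i) (3F , j) e q≢p = contradiction refl q≢p
  edge-cut x y (4F , i) (4F , j) e q≢p = contradiction refl q≢p

  edge-class : ∀ x y p q → edge x y p q ≡ true → adj C₅ (proj₁ p) (proj₁ q) ≡ true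
  edge-class x y (0F , i) (0F , j) ()
  edge-class x y (0F , i) (1F , j) e = refl
  edge-class x y (0F , i) (2F , j) ()
  edge-class x y (0F , i) (3F , j) ()
  edge-class x y (0F , i) (4F , j) e = refl
  edge-class x y (1F , i) (0F , j) e = refl
  edge-class x y (1F , i) (1F , j) ()
  edge-class x y (1F , i) (2F , j) e = refl
  edge-class x y (1F , i) (3F , j) ()
  edge-class x y (1F , i) (4F , j) ()
  edge-class x y (2F , i) (0F , j) ()
  edge-class x y (2F , i) (1F , j) e = refl
  edge-class x y (2F , i) (2F , j) ()
  edge-class x y (2F , i) (3F , j) e = refl
  edge-class x y (2F , i) (4F , j) ()
  edge-class x y (3F , i) (0F , j) ()
  edge-class x y (3F , i) (1F , j) ()
  edge-class x y (3F , i) (2F , j) e = refl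
  edge-class x y (3F , i) (3F , j) ()
  edge-class x y (3F , i) (4F , j) e = refl
  edge-class x y (4F , i) (0F , j) e = refl
  edge-class x y (4F , i) (1F , j) ()
  edge-class x y (4F , i) (2F , j) ()
  edge-class x y (4F , i) (3F , j) e = refl
  edge-class x y (4F , i) (4F , j) ()

  side : Fin (5 * s) → Bool
  side = second ∘ vertex

  partner : Fin (5 * s) → Fin (5 * s)
  partner = uncurry combine ∘ opposite ∘ vertex

  graph-local : ∀ x y v u → let z = own side (side v) x y in adj (graph x y) v u ≡ adj (graph z z) v u
  graph-local x y v u = edge-local x y (vertex v) (vertex u)

  graph-cut : ∀ x y u v → adj (graph x y) v u ≡ true → side u ≢ side v → v ≡ partner u
  graph-cut x y u v vu other =
    trans (sym (combine-remQuot {5} s v)) (cong (uncurry combine) (edge-cut x y (vertex v) (vertex u) vu other))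

  meet⇒C₅ : ∀ x y → Meet x y → graph x y ContainsCopyOf C₅
  meet⇒C₅ x y (e , x∋e , y∋e) = (λ k → combine k (index k)) , (λ {k} {l} → combine-injectiveˡ k (index k) l (index l)) , edges
    where
    i = proj₁ (remQuot {s} s e)
    j = proj₂ (remQuot {s} s e)
    ij≡e : combine i j ≡ e
    ij≡e = combine-remQuot {s} s e
    index : Fin 5 → Fin s
    index 0F = i
    index 1F = j
    index 2F = j
    index 3F = j
    index 4F = i
    ≟-refl : ∀ (a : Fin s) → does (a ≟ a) ≡ true
    ≟-refl a = dec-true (a ≟ a) refl
    x∋ij : lookup x (combine i j) ≡ true
    x∋ij = trans (cong (lookup x) ij≡e) x∋e
    y∋ij : lookup y (combine i j) ≡ true
    y∋ij = trans (cong (lookup y) ij≡e) y∋e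
    forward : ∀ {p q} → arc x y p q ≡ true → edge x y p q ≡ true
    forward {p} {q} pq = cong (_∨ arc x y q p) pq
    backward : ∀ {p q} → arc x y q p ≡ true → edge x y p q ≡ true
    backward {p} {q} qp = trans (cong (arc x y p q ∨_) qp) (Bool.∨-zeroʳ _)
    edges′ : ∀ k l → adj C₅ k l ≡ true → edge x y (k , index k) (l , index l) ≡ true
    edges′ 0F 1F _ = forward {0F , i} {1F , j} x∋ij
    edges′ 1F 0F _ = backward {1F , j} {0F , i} x∋ij
    edges′ 1F 2F _ = forward {1F , j} {2F , j} (≟-refl j)
    edges′ 2F 1F _ = backward {2F , j} {1F , j} (≟-refl j)
    edges′ 2F 3F _ = forward {2F , j} {3F , j} (≟-refl j)
    edges′ 3F 2F _ = backward {3F , j} {2F , j} (≟-refl j)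
    edges′ 3F 4F _ = forward {3F , j} {4F , i} y∋ij
    edges′ 4F 3F _ = backward {4F , i} {3F , j} y∋ij
    edges′ 4F 0F _ = forward {4F , i} {0F , i} (≟-refl i)
    edges′ 0F 4F _ = backward {0F , i} {4F , i} (≟-refl i)
    edges′ 1F 3F ()
    edges′ 1F 4F ()
    edges′ 2F 4F ()
    edges′ 4F 4F ()
    edges : ∀ k l → adj C₅ k l ≡ true → edge x y (vertex (combine k (index k))) (vertex (combine l (index l))) ≡ true
    edges k l kl = subst₂ (λ p q → edge x y p q ≡ true) (sym (remQuot-combine k (index k))) (sym (remQuot-combine l (index l))) (edges′ k l kl)

-- The factor 1 + 3 o is 1 or 4, that is ±1 modulo 5: these are the ten symmetries of the pentagon.
dihedral : Fin 2 → Fin 5 → Fin 5 → Fin 5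
dihedral o r k = (toℕ r + (1 + 3 * toℕ o) * toℕ k) mod 5

dihedral-edge : ∀ o r k → adj C₅ (dihedral o r k) (dihedral o r ((1 + toℕ k) mod 5)) ≡ true
dihedral-edge = from-yes (all? λ o → all? λ r → all? λ k → adj C₅ (dihedral o r k) (dihedral o r ((1 + toℕ k) mod 5)) Bool.≟ true)

-- A closed walk of length 5 in C₅ is a sum of five steps ±1 that vanishes
-- modulo 5, so all its steps are equal.
closed-walk : ∀ a b → adj C₅ a b ≡ true → ∀ c → adj C₅ b c ≡ true → ∀ d → adj C₅ c d ≡ true →
              ∀ e → adj C₅ d e ≡ true → adj C₅ e a ≡ true →
              ∃[ o ] ∃[ r ] (∀ k → lookup (a ∷ b ∷ c ∷ d ∷ e ∷ []) (dihedral o r k) ≡ k)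
closed-walk = from-yes
  (all? λ a → all? λ b → (adj C₅ a b Bool.≟ true) →-dec
   all? λ c → (adj C₅ b c Bool.≟ true) →-dec
   all? λ d → (adj C₅ c d Bool.≟ true) →-dec
   all? λ e → (adj C₅ d e Bool.≟ true) →-dec (adj C₅ e a Bool.≟ true) →-dec
   any? λ o → any? λ r → all? λ k → lookup (a ∷ b ∷ c ∷ d ∷ e ∷ []) (dihedral o r k) ≟ k)

module _ (s : ℕ) where
  open Gadget s

  -- The matchings force equal indices on classes 1, 2, 3 and on classes 4, 0. So the edge taken
  -- from x and the edge taken from y belong to the same pair of indices.
  aligned⇒meet : ∀ x y (g : Fin 5 → Vertex) → (∀ k → proj₁ (g k) ≡ k) →
                 (∀ k → edge x y (g k) (g ((1 + toℕ k) mod 5)) ≡ true) → Meet x y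
  aligned⇒meet x y g class edges = combine (i 0F) (i 1F) ,
    trans (sym (Bool.∨-identityʳ _)) (at 0F) ,
    subst₂ (λ a b → lookup y (combine a b) ≡ true) (matched (at 4F)) (sym (trans (matched (at 1F)) (matched (at 2F))))
      (trans (sym (Bool.∨-identityʳ _)) (at 3F))
    where
    i : Fin 5 → Fin s
    i k = proj₂ (g k)
    at : ∀ k → let l = (1 + toℕ k) mod 5 in edge x y (k , i k) (l , i l) ≡ true
    at k = subst₂ (λ a b → edge x y (a , i k) (b , i ((1 + toℕ k) mod 5)) ≡ true) (class k) (class _) (edges k)
    matched : ∀ {a b : Fin s} → does (a ≟ b) ∨ false ≡ true → a ≡ b
    matched eq = ≟-true (trans (sym (Bool.∨-identityʳ _)) eq)

  C₅⇒meet : ∀ x y → graph x y ContainsCopyOf C₅ → Meet x y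
  C₅⇒meet x y (f , _ , f-edges) =
    unwind (closed-walk (κ 0F) (κ 1F) (κ-edge 0F 1F refl) (κ 2F) (κ-edge 1F 2F refl)
                        (κ 3F) (κ-edge 2F 3F refl) (κ 4F) (κ-edge 3F 4F refl) (κ-edge 4F 0F refl))
    where
    κ : Fin 5 → Fin 5
    κ k = proj₁ (vertex (f k))
    κ-edge : ∀ k l → adj C₅ k l ≡ true → adj C₅ (κ k) (κ l) ≡ true
    κ-edge k l kl = edge-class x y (vertex (f k)) (vertex (f l)) (f-edges k l kl)
    κs = κ 0F ∷ κ 1F ∷ κ 2F ∷ κ 3F ∷ κ 4F ∷ []
    lookup-κs : ∀ k → lookup κs k ≡ κ k
    lookup-κs 0F = refl
    lookup-κs 1F = refl
    lookup-κs 2F = refl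
    lookup-κs 3F = refl
    lookup-κs 4F = refl
    unwind : (∃[ o ] ∃[ r ] (∀ k → lookup κs (dihedral o r k) ≡ k)) → Meet x y
    unwind (o , r , aligned) = aligned⇒meet x y (λ k → vertex (f (dihedral o r k)))
      (λ k → trans (sym (lookup-κs (dihedral o r k))) (aligned k))
      (λ k → f-edges _ _ (dihedral-edge o r k))

-- Edit distance

∈⇒length>0 : ∀ {A : Set} {x : A} {xs} → x ∈ xs → 0 < length xs
∈⇒length>0 (here _)  = z<s
∈⇒length>0 (there _) = z<s

pairs-count>0 : ∀ {n} (p : Fin n → Fin n → Bool) → (∀ u v → p u v ≡ p v u) → ∀ u v → u ≢ v → p u v ≡ true →
                0 < length (filterᵇ (uncurry p) (pairs n))
pairs-count>0 {n} p p-sym u v u≢v puv with Fin.<-cmp u v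
... | tri≈ _ u≡v _ = contradiction u≡v u≢v
... | tri< u<v _ _ = ∈⇒length>0 (∈-filter⁺ (T? ∘ uncurry p)
        (∈-filter⁺ (uncurry Fin._<?_) (∈-cartesianProduct⁺ (∈-allFin u) (∈-allFin v)) u<v) (subst T (sym puv) _))
... | tri> _ _ v<u = ∈⇒length>0 (∈-filter⁺ (T? ∘ uncurry p)
        (∈-filter⁺ (uncurry Fin._<?_) (∈-cartesianProduct⁺ (∈-allFin v) (∈-allFin u)) v<u) (subst T (sym (trans (p-sym v u) puv)) _))

length-cartesianProduct : ∀ {A B : Set} (xs : List A) (ys : List B) → length (cartesianProduct xs ys) ≡ length xs * length ys
length-cartesianProduct []       ys = refl
length-cartesianProduct (x ∷ xs) ys = trans (length-++ (List.map (x ,_) ys))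
  (cong₂ _+_ (length-map (x ,_) ys) (length-cartesianProduct xs ys))

∣E∣≤n² : ∀ {n} (G : Graph n) → ∣E G ∣ ≤ n * n
∣E∣≤n² {n} G = begin
  ∣E G ∣                                         ≤⟨ length-filter (T? ∘ uncurry (adj G)) (pairs n) ⟩
  length (pairs n)
    ≤⟨ length-filter (uncurry Fin._<?_) (cartesianProduct (allFin n) (allFin n)) ⟩
  length (cartesianProduct (allFin n) (allFin n)) ≡⟨ length-cartesianProduct (allFin n) (allFin n) ⟩
  length (allFin n) * length (allFin n)          ≡⟨ cong (λ k → k * k) (length-tabulate {n = n} id) ⟩
  n * n                                          ∎
  where open ≤-Reasoning

adj⇒≢ : ∀ {n} (G : Graph n) {u v} → adj G u v ≡ true → u ≢ v
adj⇒≢ G {u} uv refl = contradiction (trans (sym uv) (irrefl G u)) λ ()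

C₅⇒∣E∣>0 : ∀ {n} (G : Graph n) → G ContainsCopyOf C₅ → 0 < ∣E G ∣
C₅⇒∣E∣>0 G (f , _ , f-edges) =
  pairs-count>0 (adj G) (Graph.sym G) (f 0F) (f 1F) (adj⇒≢ G (f-edges 0F 1F refl)) (f-edges 0F 1F refl)

C₅⇒edit>0 : ∀ {n} (G H : Graph n) → G ContainsCopyOf C₅ → C₅-free H → 0 < editDistance G H
C₅⇒edit>0 {n} G H (f , f-inj , f-edges) H-free with 0 <? editDistance G H
... | yes 0<d = 0<d
... | no  0≮d = contradiction (f , (λ {_} {_} → f-inj) , λ i j ij → transfer _ _ (f-edges i j ij)) H-free
  where
  differ : Fin n → Fin n → Bool
  differ u v = adj G u v xor adj H u v
  transfer : ∀ u v → adj G u v ≡ true → adj H u v ≡ true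
  transfer u v uv with adj H u v in uv′
  ... | true  = refl
  ... | false = contradiction (pairs-count>0 differ (λ a b → cong₂ _xor_ (Graph.sym G a b) (Graph.sym H a b)) u v
                  (adj⇒≢ G uv) (cong₂ _xor_ uv uv′)) 0≮d

-- Rationals as fractions of naturals

module _ where
  open import Data.Integer.Base using (+_)

  /-≤⇒ : ∀ a b c d .{{_ : NonZero b}} .{{_ : NonZero d}} → (+ a ℚ./ b) ℚ.≤ (+ c ℚ./ d) → a * d ≤ c * b
  /-≤⇒ a b@(suc b-1) c d@(suc d-1) le = ℤ.drop‿+≤+ (subst₂ ℤ._≤_ (sym (ℤ.pos-* a d)) (sym (ℤ.pos-* c b))
    (ℚᵘ.drop-*≤* (ℚᵘ.≤-respˡ-≃ (ℚ.toℚᵘ-fromℚᵘ (mkℚᵘ (+ a) b-1))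
        (ℚᵘ.≤-respʳ-≃ (ℚ.toℚᵘ-fromℚᵘ (mkℚᵘ (+ c) d-1)) (ℚ.toℚᵘ-mono-≤ le)))))

  fromℕ-mono : ∀ {a b} → a ≤ b → fromℕ a ℚ.≤ fromℕ b
  fromℕ-mono {a} {b} a≤b = ℚ.toℚᵘ-cancel-≤ (ℚᵘ.≤-respˡ-≃ (ℚᵘ.≃-sym (ℚ.toℚᵘ-fromℚᵘ (mkℚᵘ (+ a) 0)))
    (ℚᵘ.≤-respʳ-≃ (ℚᵘ.≃-sym (ℚ.toℚᵘ-fromℚᵘ (mkℚᵘ (+ b) 0)))
      (*≤* (subst₂ ℤ._≤_ (ℤ.pos-* a 1) (ℤ.pos-* b 1) (ℤ.+≤+ (*-monoˡ-≤ 1 a≤b))))))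

  module _ (p-1 q-1 : ℕ) .(coprime : Coprime (suc p-1) (suc q-1)) where

    private
      p = suc p-1
      q = suc q-1
      ε = mkℚ (+ p) q-1 coprime

    ε*k≃ : ∀ k → toℚᵘ (ε ℚ.* fromℕ k) ℚᵘ.≃ (mkℚᵘ (+ p) q-1 ℚᵘ.* mkℚᵘ (+ k) 0)
    ε*k≃ k = ℚᵘ.≃-trans (ℚ.toℚᵘ-homo-* ε (fromℕ k)) (ℚᵘ.*-congˡ {mkℚᵘ (+ p) q-1} (ℚ.toℚᵘ-fromℚᵘ (mkℚᵘ (+ k) 0)))

    private
      numerator : ∀ k → + p ℤ.* + k ℤ.* + 1 ≡ + (p * k)
      numerator k = trans (ℤ.*-identityʳ _) (sym (ℤ.pos-* p k))
      denominator : + 1 ℤ.* + (q * 1) ≡ + q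
      denominator = trans (ℤ.*-identityˡ _) (cong +_ (*-identityʳ q))

    ε*k≤1 : ∀ k → p * k ≤ q → ε ℚ.* fromℕ k ℚ.≤ 1ℚ
    ε*k≤1 k pk≤q = ℚ.toℚᵘ-cancel-≤ (ℚᵘ.≤-respˡ-≃ (ℚᵘ.≃-sym (ε*k≃ k))
      (*≤* (subst₂ ℤ._≤_ (sym (numerator k)) (sym denominator) (ℤ.+≤+ pk≤q))))

    1≤ε*k : ∀ k → q ≤ p * k → 1ℚ ℚ.≤ ε ℚ.* fromℕ k
    1≤ε*k k q≤pk = ℚ.toℚᵘ-cancel-≤ (ℚᵘ.≤-respʳ-≃ (ℚᵘ.≃-sym (ε*k≃ k))
      (*≤* (subst₂ ℤ._≤_ (sym denominator) (sym (numerator k)) (ℤ.+≤+ q≤pk))))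

    ε≤1/D : ∀ D .{{_ : NonZero D}} → ε ℚ.≤ + 1 ℚ./ D → p * D ≤ q
    ε≤1/D D@(suc _) ε≤ = subst (p * D ≤_) (*-identityˡ q)
      (/-≤⇒ p q 1 D (subst (ℚ._≤ + 1 ℚ./ D) (sym (ℚ.↥p/↧p≡p ε)) ε≤))

    k≤⌈1/ε⌉ : ∀ k → p * k ≤ q → k ≤ ℤ.∣ ceiling (mkℚ (+ q) p-1 (Coprime.sym coprime)) ∣
    k≤⌈1/ε⌉ k pk≤q = ≤∣_∣ (ℤ.≤-trans (ℤ.≤-reflexive (sym (ℤ.neg-involutive (+ k)))) (ℤ.neg-mono-≤ F≤-k))
      where
      ≤∣_∣ : ∀ {i} → + k ℤ.≤ i → k ≤ ℤ.∣ i ∣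
      ≤∣ ℤ.+≤+ k≤i ∣ = k≤i
      -- `ceiling` is the negated floor of -q/p, so a lower bound on it is an upper bound on this
      -- floor.
      F = -[1+ q-1 ] ℤ./ + p
      F≤-k : F ℤ.≤ ℤ.- + k
      F≤-k = ℤ.*-cancelʳ-≤-pos F (ℤ.- + k) (+ p) (begin
        F ℤ.* + p         ≤⟨ ℤ.[n/d]*d≤n -[1+ q-1 ] (+ p) ⟩
        ℤ.- + q           ≤⟨ ℤ.neg-mono-≤ (ℤ.+≤+ pk≤q) ⟩
        ℤ.- + (p * k)     ≡⟨ cong (ℤ.-_ ∘ +_) (*-comm p k) ⟩
        ℤ.- + (k * p)     ≡⟨ cong ℤ.-_ (ℤ.pos-* k p) ⟩
        ℤ.- (+ k ℤ.* + p) ≡⟨ ℤ.neg-distribˡ-* (+ k) (+ p) ⟩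
        ℤ.- + k ℤ.* + p   ∎)
        where open ℤ.≤-Reasoning

-- The lower bound

n≤2^⌈log₂n⌉ : ∀ n → n ≤ 2 ^ ⌈log₂ n ⌉
n≤2^⌈log₂n⌉ = <-rec _ go
  where
  open ≤-Reasoning
  go : ∀ n → (∀ {m} → m < n → m ≤ 2 ^ ⌈log₂ m ⌉) → n ≤ 2 ^ ⌈log₂ n ⌉
  go 0 rec = z≤n
  go 1 rec = ≤-refl
  go n@(suc (suc n-2)) rec = begin
    n                              ≡⟨ ⌊n/2⌋+⌈n/2⌉≡n n ⟨
    ⌊ n /2⌋ + ⌈ n /2⌉              ≤⟨ +-monoˡ-≤ ⌈ n /2⌉ (⌊n/2⌋≤⌈n/2⌉ n) ⟩
    ⌈ n /2⌉ + ⌈ n /2⌉              ≡⟨ cong (λ k → ⌈ n /2⌉ + k) (sym (+-identityʳ ⌈ n /2⌉)) ⟩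
    2 * ⌈ n /2⌉                    ≤⟨ *-monoʳ-≤ 2 (rec (⌈n/2⌉<n n-2)) ⟩
    2 * 2 ^ ⌈log₂ ⌈ n /2⌉ ⌉        ≡⟨ cong (λ k → 2 * 2 ^ k) (⌈log₂⌈n/2⌉⌉≡⌈log₂n⌉∸1 n) ⟩
    2 ^ suc (⌈log₂ n ⌉ ∸ 1)
      ≡⟨ cong (2 ^_) (m+[n∸m]≡n {1} {⌈log₂ n ⌉} (⌈log₂⌉-mono-≤ {2} {n} (s≤s (s≤s z≤n)))) ⟩
    2 ^ ⌈log₂ n ⌉                  ∎

any-not : ∀ {A : Set} (p : A → Bool) xs → any (not ∘ p) xs ≡ not (all p xs)
any-not p []       = refl
any-not p (x ∷ xs) with p x
... | true  = any-not p xs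
... | false = refl

module _ (β γ : ℕ) .{{γ≢0 : NonZero γ}} where
  open CONGEST β γ

  module _ (A : Algorithm) (T : ℚ → ℕ) (tests : TestsC₅-freenessIn T Rounds A)
           (ε : ℚ) (0<ε : 0ℚ ℚ.< ε) (ε≤1 : ε ℚ.≤ 1ℚ) (s-1 : ℕ) where

    private
      s = suc s-1
      n = 5 * s
      t = T ε
      b = β * ⌈log₂ n ⌉
      P = A ε n
    open Program P
    open Gadget s

    n≤#IDs : n ≤ #IDs n
    n≤#IDs = ≤-trans (n≤2^⌈log₂n⌉ n) (^-monoʳ-≤ 2 (m≤n*m ⌈log₂ n ⌉ γ))

    ident : Fin n → ID n
    ident v = inject≤ v n≤#IDs

    ident-injective : ∀ {u v} → ident u ≡ ident v → u ≡ v
    ident-injective = inject≤-injective n≤#IDs n≤#IDs _ _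

    open TwoParty β γ P ident (λ {u} {v} → ident-injective {u} {v})

    private
      instance
        S≢0 : NonZero (seeds ^ n)
        S≢0 = #outcomes≢0
      S = seeds ^ n
      Rs = protocol graph side partner graph-local graph-cut t

    #accept : Subset (s * s) → Subset (s * s) → ℕ
    #accept x y = ∣ tabulate (Run.allAccept (graph x y) t) ∣

    cover≡#accept : ∀ x y → cover Rs x y ≡ #accept x y
    cover≡#accept = cover-protocol graph side partner graph-local graph-cut t

    reject+accept : ∀ x y → ∣ tabulate (Run.someRejects (graph x y) t) ∣ + #accept x y ≡ S
    reject+accept x y = trans (+-comm _ (#accept x y)) (trans
      (cong (λ p → #accept x y + ∣ p ∣) (trans (tabulate-cong λ ω → any-not (λ v → accepts (Run.stateAfter (graph x y) t ω v)) (allFin n))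
                                             (tabulate-∘ not (Run.allAccept (graph x y) t))))
      (∣W∣+∣∁W∣ (tabulate (Run.allAccept (graph x y) t))))

    disjoint⇒accept : ∀ x y → ¬ Meet x y → 2 * S ≤ 3 * cover Rs x y
    disjoint⇒accept x y x⊥y = subst (λ c → 2 * S ≤ 3 * c) (sym (cover≡#accept x y))
      (≤-trans (/-≤⇒ 2 3 (#accept x y) S (proj₁ (tests ε 0<ε ε≤1 n (network (graph x y))) (x⊥y ∘ C₅⇒meet s x y)))
               (≤-reflexive (*-comm (#accept x y) 3)))

    module _ (small : ε ℚ.* fromℕ (n * n) ℚ.≤ 1ℚ) where

      far : ∀ x y → Meet x y → (ε -FarFrom C₅-free) (graph x y)
      far x y x∩y = C₅⇒∣E∣>0 G C₅⊆G , λ H H-free → begin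
        ε ℚ.* fromℕ ∣E G ∣
          ≤⟨ ℚ.*-monoˡ-≤-nonNeg ε {{ℚ.nonNegative (ℚ.<⇒≤ 0<ε)}} (fromℕ-mono (∣E∣≤n² G)) ⟩
        ε ℚ.* fromℕ (n * n)        ≤⟨ small ⟩
        1ℚ                         ≤⟨ fromℕ-mono (C₅⇒edit>0 G H C₅⊆G H-free) ⟩
        fromℕ (editDistance G H)   ∎
        where
        open ℚ.≤-Reasoning
        G = graph x y
        C₅⊆G = meet⇒C₅ x y x∩y

      meet⇒reject : ∀ x y → Meet x y → 3 * cover Rs x y ≤ S
      meet⇒reject x y x∩y = subst (λ c → 3 * c ≤ S) (sym (cover≡#accept x y)) (+-cancelˡ-≤ (2 * S) _ _ (begin
        2 * S + 3 * a
          ≤⟨ +-monoˡ-≤ (3 * a) (/-≤⇒ 2 3 r S (proj₂ (tests ε 0<ε ε≤1 n (network (graph x y))) (far x y x∩y))) ⟩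
        r * 3 + 3 * a      ≡⟨ eq r a ⟩
        3 * (r + a)        ≡⟨ cong (3 *_) (reject+accept x y) ⟩
        3 * S              ≡⟨ +-comm S (2 * S) ⟩
        2 * S + S          ∎))
        where
        open ≤-Reasoning
        a = #accept x y
        r = ∣ tabulate (Run.someRejects (graph x y) t) ∣
        eq : ∀ r a → r * 3 + 3 * a ≡ 3 * (r + a)
        eq = solve-∀

      rounds-bound : s * s < 319 * (9 + (suc b * n * t) * 5)
      rounds-bound = disjointness Rs S (suc b * n * t) disjoint⇒accept meet⇒reject (begin
        length Rs                           ≡⟨ length-protocol graph side partner graph-local graph-cut t ⟩
        S * (#codes b ^ n) ^ t              ≤⟨ *-monoʳ-≤ S (^-monoˡ-≤ t (^-monoˡ-≤ n (#codes≤ b))) ⟩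
        S * ((2 ^ suc b) ^ n) ^ t
          ≡⟨ cong (S *_) (trans (cong (_^ t) (^-*-assoc 2 (suc b) n)) (^-*-assoc 2 (suc b * n) t)) ⟩
        S * 2 ^ (suc b * n * t)             ∎)
        where open ≤-Reasoning

  simulation-bound : (A : Algorithm) (T : ℚ → ℕ) → TestsC₅-freenessIn T Rounds A →
    ∀ ε → 0ℚ ℚ.< ε → ε ℚ.≤ 1ℚ → ∀ s .{{_ : NonZero s}} → let n = 5 * s in
    ε ℚ.* fromℕ (n * n) ℚ.≤ 1ℚ → s * s < 319 * (9 + (suc (β * ⌈log₂ n ⌉) * n * T ε) * 5)
  simulation-bound A T tests ε 0<ε ε≤1 (suc s-1) = rounds-bound A T tests ε 0<ε ε≤1 s-1

-- The choice of s makes the bound of `simulation-bound` fail. The 25 combines n = 5 s with the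
-- fifth powers; the 9 is absorbed by Q s ≥ 1.
budget : ∀ a β Q s t b → s ≡ a * (9 + 25 * suc β) * Q → 1 ≤ Q → 1 ≤ s → b * t ≤ suc β * Q →
         a * (9 + (b * (5 * s) * t) * 5) ≤ s * s
budget a β Q s t b s≡ 1≤Q 1≤s bt≤ = begin
  a * (9 + (b * (5 * s) * t) * 5)            ≡⟨ eq₁ a b s t ⟩
  a * (9 * (1 * 1) + 25 * (b * t) * s)
    ≤⟨ *-monoʳ-≤ a (+-mono-≤ (*-monoʳ-≤ 9 (*-mono-≤ 1≤Q 1≤s)) (*-monoˡ-≤ s (*-monoʳ-≤ 25 bt≤))) ⟩
  a * (9 * (Q * s) + 25 * (suc β * Q) * s)   ≡⟨ eq₂ a (suc β) Q s ⟩
  a * (9 + 25 * suc β) * Q * s               ≡⟨ cong (_* s) s≡ ⟨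
  s * s                                      ∎
  where
  open ≤-Reasoning
  eq₁ : ∀ a b s t → a * (9 + (b * (5 * s) * t) * 5) ≡ a * (9 * (1 * 1) + 25 * (b * t) * s)
  eq₁ = solve-∀
  eq₂ : ∀ a c Q s → a * (9 * (Q * s) + 25 * (c * Q) * s) ≡ a * (9 + 25 * c) * Q * s
  eq₂ = solve-∀

module _ (β : ℕ) where

  module _ (a c : ℕ) (c≡ : c ≡ a * (9 + 25 * suc β)) .{{_ : NonZero c}} (T : ℚ → ℕ)
           (bounded : ∀ ε → 0ℚ ℚ.< ε → ε ℚ.≤ 1ℚ → ∀ s .{{_ : NonZero s}} →
             ε ℚ.* fromℕ ((5 * s) * (5 * s)) ℚ.≤ 1ℚ →
             s * s < a * (9 + (suc (β * ⌈log₂ 5 * s ⌉) * (5 * s) * T ε) * 5))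
           (p-1 q-1 : ℕ) .(coprime : Coprime (suc p-1) (suc q-1)) where

    private
      p = suc p-1
      q = suc q-1
      ε = ℚ.mkℚ +[1+ p-1 ] q-1 coprime
      t = T ε
      ℓ = log1/ ε
      C = 5 * c

    -- If t were smaller, a gadget with C · max(1, ℓ t) nodes would still satisfy ε n² ≤ 1, although
    -- it is too large for t rounds by `budget`.
    rounds-large : p * (C * C) ≤ q → q ≤ p * (C * ℓ ^ 1 * t) ^ 2
    rounds-large pC²≤q = ℕ.≮⇒≥ λ few → let open TooFew few in
      <⇒≱ (bounded ε (ℚ.positive⁻¹ ε) ε≤1 s (ε*k≤1 p-1 q-1 coprime (n * n) pn²≤q))
            (budget a β Q s t (suc (β * L)) (cong (_* Q) c≡) 1≤Q 1≤s cost)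
      where
      open ≤-Reasoning
      module TooFew (few : p * (C * ℓ ^ 1 * t) ^ 2 < q) where
        -- The maximum keeps the gadget nonempty when ℓ t = 0. When it equals 1, ε n² ≤ 1 follows
        -- from ε ≤ 1/C² instead of from `few`.
        Q = 1 ⊔ ℓ * t
        s = c * Q
        n = 5 * s
        L = ⌈log₂ n ⌉
        1≤Q : 1 ≤ Q
        1≤Q = m≤m⊔n 1 (ℓ * t)
        1≤s : 1 ≤ s
        1≤s = *-mono-≤ {1} {c} {1} {Q} (>-nonZero⁻¹ c) 1≤Q
        instance
          s≢0 : NonZero s
          s≢0 = >-nonZero 1≤s
        2≤n : 2 ≤ n
        2≤n = *-mono-≤ {2} {5} {1} {s} (s≤s (s≤s z≤n)) 1≤s
        n*n≡ : n * n ≡ (C * Q) * (C * Q)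
        n*n≡ = cong (λ k → k * k) (sym (*-assoc 5 c Q))
        pn²≤q : p * (n * n) ≤ q
        pn²≤q with ⊔-sel 1 (ℓ * t)
        ... | inj₁ Q≡1 = begin
          p * (n * n)               ≡⟨ cong (p *_) n*n≡ ⟩
          p * (C * Q * (C * Q))     ≡⟨ cong (λ k → p * (k * k)) (trans (cong (C *_) Q≡1) (*-identityʳ C)) ⟩
          p * (C * C)               ≤⟨ pC²≤q ⟩
          q                         ∎
        ... | inj₂ Q≡ℓt = begin
          p * (n * n)               ≡⟨ cong (p *_) n*n≡ ⟩
          p * (C * Q * (C * Q))     ≡⟨ cong (λ k → p * (C * k * (C * k))) Q≡ℓt ⟩
          p * (C * (ℓ * t) * (C * (ℓ * t))) ≡⟨ cong (p *_) (eq C ℓ t) ⟩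
          p * (C * ℓ ^ 1 * t) ^ 2   ≤⟨ <⇒≤ few ⟩
          q                         ∎
          where
          eq : ∀ C ℓ t → C * (ℓ * t) * (C * (ℓ * t)) ≡ (C * (ℓ * 1) * t) * ((C * (ℓ * 1) * t) * 1)
          eq = solve-∀
        n≤n² : n ≤ n * n
        n≤n² = m≤m*n n n {{>-nonZero (<⇒≤ 2≤n)}}
        pn≤q : p * n ≤ q
        pn≤q = ≤-trans (*-monoʳ-≤ p n≤n²) pn²≤q
        ε≤1 : ε ℚ.≤ 1ℚ
        ε≤1 = subst (ℚ._≤ 1ℚ) (ℚ.*-identityʳ ε)
          (ε*k≤1 p-1 q-1 coprime 1 (≤-trans (*-monoʳ-≤ p (<⇒≤ 2≤n)) pn≤q))
        -- From ε n ≤ 1 follows n ≤ ⌈1/ε⌉, so message lengths are bounded in terms of log(1/ε). This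
        -- is the only logarithm lost, whence k = 1.
        L≤ℓ : L ≤ ℓ
        L≤ℓ = ⌈log₂⌉-mono-≤ (k≤⌈1/ε⌉ p-1 q-1 coprime n pn≤q)
        -- Lets ℓ absorb the extra bit that the encoding of shorter messages costs.
        1≤ℓ : 1 ≤ ℓ
        1≤ℓ = ≤-trans (⌈log₂⌉-mono-≤ 2≤n) L≤ℓ
        cost : suc (β * L) * t ≤ suc β * Q
        cost = begin
          suc (β * L) * t   ≤⟨ *-monoˡ-≤ t (+-mono-≤ 1≤ℓ (*-monoʳ-≤ β L≤ℓ)) ⟩
          suc β * ℓ * t     ≡⟨ *-assoc (suc β) ℓ t ⟩
          suc β * (ℓ * t)   ≤⟨ *-monoʳ-≤ (suc β) (m≤n⊔m 1 (ℓ * t)) ⟩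
          suc β * Q         ∎

mainTheorem9 : (β γ : ℕ) .{{_ : NonZero γ}} → let open CONGEST β γ in
    ∃[ C ] ∃[ k ] ∃[ ε₀ ] Positive ε₀ ×
    ((A : Algorithm) (T : ℚ → ℕ) → TestsC₅-freenessIn T Rounds A →
    (ε : ℚ) .{{_ : Positive ε}} → ε ℚ.≤ ε₀ → AtLeastΩ̃1/√ C k ε (T ε))
mainTheorem9 β γ = C , 1 , ℤ.+ 1 ℚ./ (C * C) , ℚ.normalize-pos 1 (C * C) , bound
  where
  open CONGEST β γ
  -- Five classes of s nodes each, the doubling length 319 of `disjointness`, and the cost computed
  -- in `budget`.
  C = 5 * (319 * (9 + 25 * suc β))
  bound : (A : Algorithm) (T : ℚ → ℕ) → TestsC₅-freenessIn T Rounds A →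
          (ε : ℚ) .{{_ : Positive ε}} → ε ℚ.≤ ℤ.+ 1 ℚ./ (C * C) → AtLeastΩ̃1/√ C 1 ε (T ε)
  bound A T tests ε@(ℚ.mkℚ +[1+ p-1 ] q-1 coprime) ε≤ =
    1≤ε*k p-1 q-1 coprime _ (rounds-large β 319 (319 * (9 + 25 * suc β)) refl T (simulation-bound β γ A T tests) p-1 q-1 coprime (ε≤1/D p-1 q-1 coprime (C * C) ε≤))
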